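{- Let $W$ be a Coxeter group with set $S$ of simple reflections. For every $w\in W$, $$\frac{\ell_T(w)+\ell_S(w)}{2} \leq \mathrm{dp}(w) \leq \ell_S(w).$$
   Context: $T=\{wsw^{ -1}: w\in W, s\in S\}$ is the set of all reflections of $W$. $\ell_S(w)$ (length) and $\ell_T(w)$ (reflection length) are the minimal numbers of factors in an expression of $w$ as a product of elements of $S$, respectively of $T$. Let $\Phi=\Pi\cup(-\Pi)$ be the root system associated to $(W,S)$, with $\Pi$ the positive roots; each positive root $\beta$ corresponds to a reflection $t_\beta\in T$ with $t_\beta(\beta)=-\beta$, and $\beta\mapsto t_\beta$ is a bijection $\Pi\to T$. The depth of a positive root is $\mathrm{dp}(\beta)=\min\{k : s_1\cdots s_k(\beta)\in -\Pi \text{ for some } s_1,\dots,s_k\in S\}$. The depth of $w\in W$ is $$\mathrm{dp}(w)=\min\Big\{\sum_{i=1}^k \mathrm{dp}(\beta_i) : k\ge 0,\ w=t_{\beta_1}\cdots t_{\beta_k},\ \beta_i\in\Pi\Big\},$$ with the identity being the empty product. -}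

module Defs where

open import Algebra.Bundles using (Group; CommutativeRing)
open import Data.List.Base using (List; []; _∷_; _++_; [_]; map; foldr; sum; length; concat; replicate)
open import Data.List.Relation.Unary.All using (All)
open import Data.Nat.Base as ℕ using (ℕ; zero; suc)
import Data.Nat.Properties as ℕ
open import Data.Product.Base using (∃; ∃₂; _×_; _,_; proj₁)
open import Function.Bundles using (_⇔_; Equivalence)
open import Level using (Level; _⊔_) renaming (suc to lsuc)
open import Relation.Binary.Core using (Rel)
open import Relation.Binary.Definitions using (DecidableEquality)
open import Relation.Binary.PropositionalEquality.Core using (_≡_)
open import Relation.Binary.Structures using (IsDecTotalOrder)
open import Relation.Nullary.Decidable.Core using (yes; no; map′)
open import Relation.Nullary.Negation.Core using (¬_)

-- Minima are predicates: constructively, the minimum of a nonempty set of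
-- natural numbers given by an undecidable predicate need not be computable.
IsMin : ∀ {p} → (ℕ → Set p) → ℕ → Set p
IsMin P n = P n × (∀ k → P k → n ℕ.≤ k)

-- The value 0 encodes m(s,t) = ∞.
record CoxeterMatrix {s} (S : Set s) : Set s where
  field
    m     : S → S → ℕ
    m-sym : ∀ x y → m x y ≡ m y x
    m≡1   : ∀ x y → m x y ≡ 1 ⇔ x ≡ y

  infix 4 _≟_
  _≟_ : DecidableEquality S
  x ≟ y = map′ (Equivalence.to (m≡1 x y)) (Equivalence.from (m≡1 x y)) (m x y ℕ.≟ 1)

  -- The congruence on words generated by (xy)^m(x,y) = 1.  When
  -- m x y = 0 the relator is the empty word.  Since m x x = 1 gives xx = 1,
  -- words modulo _∼_ form the group presented by these relators.
  infix 4 _∼_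
  data _∼_ : Rel (List S) s where
    ∼-refl  : ∀ {u} → u ∼ u
    ∼-sym   : ∀ {u v} → u ∼ v → v ∼ u
    ∼-trans : ∀ {u v w} → u ∼ v → v ∼ w → u ∼ w
    ∼-cong  : ∀ {u u′ v v′} → u ∼ u′ → v ∼ v′ → u ++ v ∼ u′ ++ v′
    relator : ∀ x y → concat (replicate (m x y) (x ∷ y ∷ [])) ∼ []

record CoxeterSystem (s c ℓ : Level) : Set (lsuc (s ⊔ c ⊔ ℓ)) where
  field
    S      : Set s
    matrix : CoxeterMatrix S
    group  : Group c ℓ

  open CoxeterMatrix matrix public
  open Group group public
    using (_≈_; _∙_; ε; _⁻¹) renaming (Carrier to W)

  product : List W → W
  product = foldr _∙_ ε

  field
    σ : S → W

  ⟦_⟧ : List S → W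
  ⟦ u ⟧ = product (map σ u)

  field
    generates : ∀ w → ∃ λ u → ⟦ u ⟧ ≈ w
    presents  : ∀ u v → ⟦ u ⟧ ≈ ⟦ v ⟧ ⇔ u ∼ v

  word : W → List S
  word w = proj₁ (generates w)

  T : W → Set (s ⊔ c ⊔ ℓ)
  T t = ∃₂ λ w x → t ≈ w ∙ σ x ∙ w ⁻¹

  IsLengthS : W → ℕ → Set (s ⊔ ℓ)
  IsLengthS w = IsMin λ n → ∃ λ u → length u ≡ n × w ≈ ⟦ u ⟧

  IsLengthT : W → ℕ → Set (s ⊔ c ⊔ ℓ)
  IsLengthT w = IsMin λ n → ∃ λ ts → All T ts × length ts ≡ n × w ≈ product ts

record OrderedField (c ℓ₁ ℓ₂ : Level) : Set (lsuc (c ⊔ ℓ₁ ⊔ ℓ₂)) where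
  field
    commutativeRing : CommutativeRing c ℓ₁

  open CommutativeRing commutativeRing public
    using (_≈_; _+_; _*_; -_; 0#; 1#) renaming (Carrier to K)

  infix 4 _≤_ _<_
  field
    _≤_             : Rel K ℓ₂
    isDecTotalOrder : IsDecTotalOrder _≈_ _≤_
    +-monoˡ-≤       : ∀ z {x y} → x ≤ y → x + z ≤ y + z
    *-nonNeg        : ∀ {x y} → 0# ≤ x → 0# ≤ y → 0# ≤ x * y
    0≉1             : ¬ (0# ≈ 1#)
    inverse         : ∀ x → ¬ (x ≈ 0#) → ∃ λ y → x * y ≈ 1#

  _<_ : Rel K (ℓ₁ ⊔ ℓ₂)
  x < y = x ≤ y × ¬ (x ≈ y)

  -- Chebyshev polynomials of the second kind, shifted and rescaled:
  -- cheb (2 cos θ) k = sin (kθ) / sin θ.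
  cheb : K → ℕ → K
  cheb x zero          = 0#
  cheb x (suc zero)    = 1#
  cheb x (suc (suc k)) = x * cheb x (suc k) + - cheb x k

  -- IsTwoCos m x says that x = 2 cos (π / m), with cos (π / ∞) = 1 (∞ being
  -- encoded by 0).  For m ≥ 2 the number 2 cos (π / m) is the only x with
  -- cheb x m = 0 and cheb x k > 0 for 0 < k < m: writing x = 2 cos θ with
  -- 0 < θ < π, this says that mθ is the first positive multiple of θ at which
  -- sine stops being positive and that sin (mθ) = 0, i.e. mθ = π.
  data IsTwoCos : ℕ → K → Set (c ⊔ ℓ₁ ⊔ ℓ₂) where
    two-cos-∞ : ∀ {x} → x ≈ 1# + 1# → IsTwoCos 0 x
    two-cos-1 : ∀ {x} → x ≈ - (1# + 1#) → IsTwoCos 1 x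
    two-cos-m : ∀ {m x} → 2 ℕ.≤ m → cheb x m ≈ 0# →
          (∀ k → 0 ℕ.< k → k ℕ.< m → 0# < cheb x k) → IsTwoCos m x

-- ℝ is replaced by an arbitrary ordered field containing the numbers
-- 2 cos (π / m) for those m that occur in the Coxeter matrix.
record Cosines {s c ℓ f ℓ₁ ℓ₂}
               (C : CoxeterSystem s c ℓ) (F : OrderedField f ℓ₁ ℓ₂) :
               Set (s ⊔ f ⊔ ℓ₁ ⊔ ℓ₂) where
  open CoxeterSystem C using (S; m)
  open OrderedField F using (K; IsTwoCos)
  field
    twoCos   : ℕ → K
    isTwoCos : ∀ (x y : S) → IsTwoCos (m x y) (twoCos (m x y))

module RootSystem {s c ℓ f ℓ₁ ℓ₂}
                  (C : CoxeterSystem s c ℓ) (F : OrderedField f ℓ₁ ℓ₂)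
                  (cosines : Cosines C F) where
  open CoxeterSystem C
  open OrderedField F using (K; _+_; _*_; -_; 0#; 1#; _≤_) renaming (_≈_ to _≈ᴷ_)
  open Cosines cosines

  -- The free K-module on S: a list of pairs (a , x) stands for the sum of the
  -- a · α x.
  V : Set (s ⊔ f)
  V = List (K × S)

  α : S → V
  α x = [ (1# , x) ]

  -ᵛ_ : V → V
  -ᵛ_ = map λ (a , x) → (- a , x)

  coeff : V → S → K
  coeff []            y = 0#
  coeff ((a , x) ∷ v) y with x ≟ y
  ... | yes _ = a + coeff v y
  ... | no  _ = coeff v y

  infix 4 _≈ᵛ_
  _≈ᵛ_ : Rel V (s ⊔ ℓ₁)
  v ≈ᵛ v′ = ∀ x → coeff v x ≈ᴷ coeff v′ x

  -- twoB x v = 2 B(α x , v), where B(α x , α y) = - cos (π / m(x,y)).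
  twoB : S → V → K
  twoB x []            = 0#
  twoB x ((a , y) ∷ v) = a * - twoCos (m x y) + twoB x v

  -- reflect x v = v - 2 B(α x , v) α x
  reflect : S → V → V
  reflect x v = (- twoB x v , x) ∷ v

  act : List S → V → V
  act u v = foldr reflect v u

  -- The action of W.  Up to _≈ᵛ_ it does not depend on the word chosen for w,
  -- since the reflections satisfy the Coxeter relations.
  infixr 8 _•_
  _•_ : W → V → V
  w • v = act (word w) v

  Φ : V → Set (s ⊔ c ⊔ ℓ₁)
  Φ β = ∃₂ λ w x → β ≈ᵛ w • α x

  Π : V → Set (s ⊔ c ⊔ ℓ₁ ⊔ ℓ₂)
  Π β = Φ β × (∀ x → 0# ≤ coeff β x)

  -Π : V → Set (s ⊔ c ⊔ ℓ₁ ⊔ ℓ₂)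
  -Π β = Π (-ᵛ β)

  IsRootDepth : V → ℕ → Set (s ⊔ c ⊔ ℓ₁ ⊔ ℓ₂)
  IsRootDepth β = IsMin λ k → ∃ λ u → length u ≡ k × -Π (act u β)

  -- A factor t = t_β, characterized by t ∈ T and t(β) = -β, together with the
  -- value of dp(β).
  record Factor : Set (s ⊔ c ⊔ ℓ ⊔ f ⊔ ℓ₁ ⊔ ℓ₂) where
    field
      β        : V
      β∈Π      : Π β
      t        : W
      t∈T      : T t
      t•β≈-β   : t • β ≈ᵛ -ᵛ β
      dpβ      : ℕ
      isDepthβ : IsRootDepth β dpβ

  IsDepth : W → ℕ → Set (s ⊔ c ⊔ ℓ ⊔ f ⊔ ℓ₁ ⊔ ℓ₂)
  IsDepth w = IsMin λ n → ∃ λ (ts : List Factor) →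
    w ≈ product (map Factor.t ts) × sum (map Factor.dpβ ts) ≡ n

{-# OPTIONS --safe #-}
module Submission where

-- If s₁⋯s_k is a shortest word making β negative, then s₂⋯s_k(β) is a positive
-- root made negative by s₁, hence a multiple of the simple root of s₁.  So t_β
-- is conjugate to s₁ by s₂⋯s_k and ℓ_S(t_β) ≤ 2 dp(β) - 1.  Summing this over a
-- factorization of w into k reflections with Σ dp(β_i) = dp(w) gives
-- ℓ_S(w) ≤ 2 dp(w) - k ≤ 2 dp(w) - ℓ_T(w); the upper bound holds because simple
-- reflections have depth 1.
--
-- Signs of roots and the faithfulness of the representation come from: for every
-- word u and x ∈ S, either u(α x) is nonnegative or ux equals a word shorter
-- than u.  This is decided by pushing letters x, y to the right end of u = vd
-- until v(α x) and v(α y) are nonnegative, y being the last letter of u.  If d is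
-- alternating and shorter than m(x,y), then d(α x) has Chebyshev, hence
-- nonnegative, coefficients; otherwise dx can be shortened inside ⟨x, y⟩.

open import Defs
open import Algebra.Bundles using (CommutativeRing; Group; RawRing)
import Algebra.Properties.CommutativeSemigroup as CommutativeSemigroupProperties
import Algebra.Properties.Group as GroupProperties
import Algebra.Properties.Ring as RingProperties
import Algebra.Properties.Semiring.Mult as SemiringMult
import Algebra.Solver.Ring as RingSolver
open import Algebra.Solver.Ring.AlmostCommutativeRing
  using (_-Raw-AlmostCommutative⟶_; Induced-equivalence; fromCommutativeRing)
open import Data.Bool.Base using (Bool; true; false; not; if_then_else_)
open import Data.Bool.Properties using (not-involutive; ¬-not) renaming (_≟_ to _≟ᵇ_)
open import Data.Empty using (⊥-elim)
open import Data.Integer.Base using (+_)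
import Data.Integer.Base as ℤ
import Data.Integer.Properties as ℤ
open import Data.List.Base
  using (List; []; _∷_; _++_; [_]; map; foldr; length; replicate; concat; reverse;
         initLast; _∷ʳ′_)
open import Data.List.Properties
  using (foldr-++; unfold-reverse; reverse-++; reverse-involutive; ++-assoc;
         ++-identityʳ; length-++; length-map; length-reverse; map-++)
open import Data.List.Relation.Unary.All using (All; []; _∷_)
open import Data.Maybe.Base using (just; nothing)
open import Data.Nat.Base as ℕ using (ℕ; zero; suc; z≤n; s≤s)
import Data.Nat.Properties as ℕ
open import Data.Product.Base using (∃; ∃₂; _×_; _,_; proj₁; proj₂)
import Data.Rational.Properties as ℚ
import Data.Rational.Unnormalised.Base as ℚᵘ
import Data.Rational.Unnormalised.Properties as ℚᵘ
open import Data.Sum.Base using (_⊎_; inj₁; inj₂)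
open import Function.Base using (_∘_)
open import Function.Bundles using (Equivalence)
open import Level using (0ℓ)
open import Relation.Binary.Bundles using (Setoid)
open import Relation.Binary.Definitions using (WeaklyDecidable)
open import Relation.Binary.PropositionalEquality as ≡
  using (_≡_; _≢_; module ≡-Reasoning)
import Relation.Binary.Reasoning.Setoid as SetoidReasoning
open import Relation.Binary.Structures using (IsDecTotalOrder)
open import Relation.Nullary.Decidable.Core using (yes; no)
open import Relation.Nullary.Negation.Core using (¬_)

-- A ring solver over an abstract commutative ring.

-- The coefficient pair (a , b) stands for the integer a - b: unlike elements
-- of the abstract ring, such pairs compute, so that the solver can cancel.
module IntegerCoefficients {c ℓ} (R : CommutativeRing c ℓ) where
  open CommutativeRing R
  open RingProperties ring
  open SemiringMult semiring using (×-homo-+; ×1-homo-*) renaming (_×_ to _·_)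
  open SetoidReasoning setoid
  private
    open CommutativeSemigroupProperties +-commutativeSemigroup using (interchange)

    cancel : ℕ → ℕ → ℕ × ℕ
    cancel (suc a) (suc b) = cancel a b
    cancel a       b       = a , b

    ⟦_⟧ : ℕ × ℕ → Carrier
    ⟦ a , b ⟧ = a · 1# - b · 1#

    differences : RawRing 0ℓ 0ℓ
    differences = record
      { Carrier = ℕ × ℕ
      ; _≈_     = _≡_
      ; _+_     = λ (a , b) (a′ , b′) → cancel (a ℕ.+ a′) (b ℕ.+ b′)
      ; _*_     = λ (a , b) (a′ , b′) →
                    cancel (a ℕ.* a′ ℕ.+ b ℕ.* b′) (a ℕ.* b′ ℕ.+ b ℕ.* a′)
      ; -_      = λ (a , b) → b , a
      ; 0#      = 0 , 0
      ; 1#      = 1 , 0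
      }

    +-homo : ∀ a b a′ b′ →
             (a ℕ.+ a′) · 1# - (b ℕ.+ b′) · 1# ≈ (a · 1# - b · 1#) + (a′ · 1# - b′ · 1#)
    +-homo a b a′ b′ = begin
      (a ℕ.+ a′) · 1# - (b ℕ.+ b′) · 1#
        ≈⟨ +-cong (×-homo-+ 1# a a′) (-‿cong (×-homo-+ 1# b b′)) ⟩
      (a · 1# + a′ · 1#) - (b · 1# + b′ · 1#)
        ≈⟨ +-congˡ (-‿+-comm _ _) ⟨
      (a · 1# + a′ · 1#) + (- (b · 1#) - b′ · 1#)
        ≈⟨ interchange _ _ _ _ ⟩
      (a · 1# - b · 1#) + (a′ · 1# - b′ · 1#) ∎

    ·-+* : ∀ a b a′ b′ →
           (a ℕ.* a′ ℕ.+ b ℕ.* b′) · 1# ≈ a · 1# * a′ · 1# + b · 1# * b′ · 1#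
    ·-+* a b a′ b′ = trans (×-homo-+ 1# (a ℕ.* a′) (b ℕ.* b′))
                           (+-cong (×1-homo-* a a′) (×1-homo-* b b′))

    [x-y][z-w] : ∀ x y z w → (x - y) * (z - w) ≈ (x * z + y * w) - (x * w + y * z)
    [x-y][z-w] x y z w = begin
      (x - y) * (z - w)
        ≈⟨ [y-z]x≈yx-zx (z - w) x y ⟩
      x * (z - w) - y * (z - w)
        ≈⟨ +-cong (x[y-z]≈xy-xz x z w) (-‿cong (x[y-z]≈xy-xz y z w)) ⟩
      (x * z - x * w) - (y * z - y * w)
        ≈⟨ +-congˡ (-‿+-comm _ _) ⟨
      (x * z - x * w) + (- (y * z) + - - (y * w))
        ≈⟨ +-congˡ (trans (+-comm _ _) (+-congʳ (-‿involutive _))) ⟩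
      (x * z - x * w) + (y * w - y * z)
        ≈⟨ interchange _ _ _ _ ⟩
      (x * z + y * w) + (- (x * w) - y * z)
        ≈⟨ +-congˡ (-‿+-comm _ _) ⟩
      (x * z + y * w) - (x * w + y * z) ∎

    -- Adding `b′ - b′` on the left and `b - b` on the right brings both sides to the same pair of
    -- sums.
    difference-≈ : ∀ a b a′ b′ → a ℕ.+ b′ ≡ a′ ℕ.+ b → ⟦ a , b ⟧ ≈ ⟦ a′ , b′ ⟧
    difference-≈ a b a′ b′ eq = begin
      a · 1# - b · 1#
        ≈⟨ +-identityʳ _ ⟨
      (a · 1# - b · 1#) + 0#
        ≈⟨ +-congˡ (-‿inverseʳ _) ⟨
      (a · 1# - b · 1#) + (b′ · 1# - b′ · 1#)
        ≈⟨ +-homo a b b′ b′ ⟨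
      (a ℕ.+ b′) · 1# - (b ℕ.+ b′) · 1#
        ≡⟨ ≡.cong₂ (λ m n → m · 1# - n · 1#) eq (ℕ.+-comm b b′) ⟩
      (a′ ℕ.+ b) · 1# - (b′ ℕ.+ b) · 1#
        ≈⟨ +-homo a′ b′ b b ⟩
      (a′ · 1# - b′ · 1#) + (b · 1# - b · 1#)
        ≈⟨ +-congˡ (-‿inverseʳ _) ⟩
      (a′ · 1# - b′ · 1#) + 0#
        ≈⟨ +-identityʳ _ ⟩
      a′ · 1# - b′ · 1# ∎

    cancel-≡ : ∀ a b → proj₁ (cancel a b) ℕ.+ b ≡ a ℕ.+ proj₂ (cancel a b)
    cancel-≡ zero    b       = ≡.refl
    cancel-≡ (suc a) zero    = ≡.refl
    cancel-≡ (suc a) (suc b) = ≡.trans (ℕ.+-suc _ b) (≡.cong suc (cancel-≡ a b))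

    cancel-≈ : ∀ a b → ⟦ cancel a b ⟧ ≈ ⟦ a , b ⟧
    cancel-≈ a b = difference-≈ _ _ a b (cancel-≡ a b)

    -- Sends 0 and 1 to 0# and 1# on the nose, so that solver equations may
    -- contain these constants.
    ⟦_⟧′ : ℕ × ℕ → Carrier
    ⟦ 0 , 0 ⟧′ = 0#
    ⟦ 1 , 0 ⟧′ = 1#
    ⟦ p ⟧′     = ⟦ p ⟧

    ⟦⟧′≈⟦⟧ : ∀ p → ⟦ p ⟧′ ≈ ⟦ p ⟧
    ⟦⟧′≈⟦⟧ (0 , 0)           = sym (-‿inverseʳ 0#)
    ⟦⟧′≈⟦⟧ (0 , suc _)       = refl
    ⟦⟧′≈⟦⟧ (1 , 0)           =
      sym (trans (+-cong (+-identityʳ 1#) -0#≈0#) (+-identityʳ 1#))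
    ⟦⟧′≈⟦⟧ (1 , suc _)       = refl
    ⟦⟧′≈⟦⟧ (suc (suc _) , _) = refl

    homomorphism : differences -Raw-AlmostCommutative⟶ fromCommutativeRing R
    homomorphism = record
      { ⟦_⟧    = ⟦_⟧′
      ; +-homo = λ p@(a , b) q@(a′ , b′) →
          trans (⟦⟧′≈⟦⟧ (cancel (a ℕ.+ a′) (b ℕ.+ b′)))
          (trans (cancel-≈ (a ℕ.+ a′) (b ℕ.+ b′))
          (trans (+-homo a b a′ b′)
                 (sym (+-cong (⟦⟧′≈⟦⟧ p) (⟦⟧′≈⟦⟧ q)))))
      ; *-homo = λ p@(a , b) q@(a′ , b′) →
          let m = a ℕ.* a′ ℕ.+ b ℕ.* b′; n = a ℕ.* b′ ℕ.+ b ℕ.* a′ in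
          trans (⟦⟧′≈⟦⟧ (cancel m n))
          (trans (cancel-≈ m n)
          (trans (+-cong (·-+* a b a′ b′) (-‿cong (·-+* a b b′ a′)))
          (trans (sym ([x-y][z-w] _ _ _ _))
                 (sym (*-cong (⟦⟧′≈⟦⟧ p) (⟦⟧′≈⟦⟧ q))))))
      ; -‿homo = λ p@(a , b) →
          trans (⟦⟧′≈⟦⟧ (b , a))
          (trans (sym (trans (sym (-‿+-comm _ _))
                      (trans (+-congˡ (-‿involutive _)) (+-comm _ _))))
                 (-‿cong (sym (⟦⟧′≈⟦⟧ p))))
      ; 0-homo = refl
      ; 1-homo = refl
      }

    -- Only pairs that stand for the same integer are recognised; coincidences due to the
    -- characteristic of the ring give `nothing`.
    _≟_ : WeaklyDecidable (Induced-equivalence homomorphism)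
    (a , b) ≟ (a′ , b′) with a ℕ.+ b′ ℕ.≟ a′ ℕ.+ b
    ... | yes eq =
      just (trans (⟦⟧′≈⟦⟧ (a , b)) (trans (difference-≈ a b a′ b′ eq) (sym (⟦⟧′≈⟦⟧ (a′ , b′)))))
    ... | no  _  = nothing

  open RingSolver differences (fromCommutativeRing R) homomorphism _≟_ public
    using (Polynomial; solve; _:=_; _:+_; _:*_; _:-_; :-_; con)

  :0 :1 : ∀ {n} → Polynomial n
  :0 = con (0 , 0)
  :1 = con (1 , 0)

-- Words modulo the Coxeter relations.

module Words {s} {S : Set s} (matrix : CoxeterMatrix S) where
  open CoxeterMatrix matrix

  wordSetoid : Setoid s s
  wordSetoid = record
    { Carrier       = List S
    ; _≈_           = _∼_
    ; isEquivalence = record { refl = ∼-refl ; sym = ∼-sym ; trans = ∼-trans }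
    }
  open SetoidReasoning wordSetoid

  ++-congˡ : ∀ u {v v′} → v ∼ v′ → u ++ v ∼ u ++ v′
  ++-congˡ u e = ∼-cong (∼-refl {u}) e

  ++-congʳ : ∀ {u u′} v → u ∼ u′ → u ++ v ∼ u′ ++ v
  ++-congʳ v e = ∼-cong e (∼-refl {v})

  xx∼[] : ∀ x → x ∷ x ∷ [] ∼ []
  xx∼[] x = ≡.subst (λ n → concat (replicate n (x ∷ x ∷ [])) ∼ [])
                    (Equivalence.from (m≡1 x x) ≡.refl) (relator x x)

  -- Every letter is its own inverse, so reversal of words represents inversion.
  reverse-inverseˡ : ∀ u → reverse u ++ u ∼ []
  reverse-inverseˡ []      = ∼-refl
  reverse-inverseˡ (x ∷ u) = begin
    reverse (x ∷ u) ++ x ∷ u       ≡⟨ ≡.cong (_++ x ∷ u) (unfold-reverse x u) ⟩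
    (reverse u ++ [ x ]) ++ x ∷ u  ≡⟨ ++-assoc (reverse u) [ x ] (x ∷ u) ⟩
    reverse u ++ x ∷ x ∷ u         ≈⟨ ++-congˡ (reverse u) (++-congʳ u (xx∼[] x)) ⟩
    reverse u ++ u                 ≈⟨ reverse-inverseˡ u ⟩
    []                             ∎

  reverse-inverseʳ : ∀ u → u ++ reverse u ∼ []
  reverse-inverseʳ u = ≡.subst (λ v → v ++ reverse u ∼ []) (reverse-involutive u)
                               (reverse-inverseˡ (reverse u))

  ++∼[]⇒∼reverse : ∀ u v → u ++ v ∼ [] → u ∼ reverse v
  ++∼[]⇒∼reverse u v e = begin
    u                    ≡⟨ ++-identityʳ u ⟨
    u ++ []              ≈⟨ ++-congˡ u (reverse-inverseʳ v) ⟨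
    u ++ (v ++ reverse v) ≡⟨ ++-assoc u v (reverse v) ⟨
    (u ++ v) ++ reverse v ≈⟨ ++-congʳ (reverse v) e ⟩
    reverse v            ∎

  ++[]∼⇒∼++[] : ∀ u v x → u ++ [ x ] ∼ v → u ∼ v ++ [ x ]
  ++[]∼⇒∼++[] u v x e = begin
    u                    ≡⟨ ++-identityʳ u ⟨
    u ++ []              ≈⟨ ++-congˡ u (xx∼[] x) ⟨
    u ++ ([ x ] ++ [ x ]) ≡⟨ ++-assoc u [ x ] [ x ] ⟨
    (u ++ [ x ]) ++ [ x ] ≈⟨ ++-congʳ [ x ] e ⟩
    v ++ [ x ]           ∎

  conjugate : List S → List S → List S
  conjugate u v = u ++ v ++ reverse u

  conjugate-cong : ∀ u {v v′} → v ∼ v′ → conjugate u v ∼ conjugate u v′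
  conjugate-cong u e = ++-congˡ u (++-congʳ (reverse u) e)

  conjugate-++ : ∀ u v w → conjugate (u ++ v) w ≡ conjugate u (conjugate v w)
  conjugate-++ u v w = ≡.trans (++-assoc u v _) (≡.cong (u ++_) (≡.trans
    (≡.cong (λ r → v ++ w ++ r) (reverse-++ u v))
    (≡.trans (≡.cong (v ++_) (≡.sym (++-assoc w (reverse v) (reverse u))))
             (≡.sym (++-assoc v (w ++ reverse v) (reverse u))))))

  conjugate-[] : ∀ {u} → u ∼ [] → ∀ v → conjugate u v ∼ v
  conjugate-[] {u} u∼[] v = begin
    u ++ v ++ reverse u  ≈⟨ ++-congʳ (v ++ reverse u) u∼[] ⟩
    v ++ reverse u       ≈⟨ ++-congˡ v (++-congʳ (reverse u) u∼[]) ⟨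
    v ++ u ++ reverse u  ≈⟨ ++-congˡ v (reverse-inverseʳ u) ⟩
    v ++ []              ≡⟨ ++-identityʳ v ⟩
    v                    ∎

  conjugate-reverse : ∀ u v → conjugate (reverse u) (conjugate u v) ∼ v
  conjugate-reverse u v = ≡.subst (_∼ v) (conjugate-++ (reverse u) u v)
                                  (conjugate-[] (reverse-inverseˡ u) v)

  length-∷ʳ : ∀ (u : List S) x → length (u ++ [ x ]) ≡ suc (length u)
  length-∷ʳ u x = ≡.trans (length-++ u) (ℕ.+-comm (length u) 1)

  -- The word `u` need not be reduced; for a reduced `u` this is the usual condition that
  -- multiplication by `x` on the right lowers the length.
  Descent : List S → S → Set s
  Descent u x = ∃ λ u′ → u ++ [ x ] ∼ u′ × length u′ ℕ.< length u

  -- Alternating words in two letters.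

  module Dihedral (x y : S) where
    -- Booleans keep the two letters apart formally even if `x` and `y` coincide, a case that does
    -- occur.
    letter : Bool → S
    letter b = if b then x else y

    letters : List Bool → List S
    letters = map letter

    m-letter : ∀ b → m (letter b) (letter (not b)) ≡ m x y
    m-letter true  = ≡.refl
    m-letter false = m-sym y x

    alternating : Bool → ℕ → List Bool
    alternating b zero    = []
    alternating b (suc n) = b ∷ alternating (not b) n

    -- Only the length of the remainder `w` is recorded, which is all that the braid relation below
    -- needs.
    alternating-split : ∀ b j k → ∃ λ w → length w ≡ k × alternating b (j ℕ.+ k) ≡ alternating b j ++ w
    alternating-split b zero    zero    = [] , ≡.refl , ≡.refl
    alternating-split b zero    (suc k) with alternating-split (not b) zero k
    ... | w , l , e = b ∷ w , ≡.cong suc l , ≡.cong (b ∷_) e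
    alternating-split b (suc j) k with alternating-split (not b) j k
    ... | w , l , e = w , l , ≡.cong (b ∷_) e

    relator-alternating : ∀ b k →
      concat (replicate k (letter b ∷ letter (not b) ∷ [])) ≡ letters (alternating b (k ℕ.* 2))
    relator-alternating b zero    = ≡.refl
    relator-alternating b (suc k) = ≡.cong (λ w → letter b ∷ letter (not b) ∷ w)
      (≡.trans (relator-alternating b k)
               (≡.cong (λ b′ → letters (alternating b′ (k ℕ.* 2))) (≡.sym (not-involutive b))))

    -- With `m = n + 1`, the relator is the alternating word of length `2 m`. Its first `m + 1`
    -- letters are therefore inverse to the remaining `m - 1`, whose reversal is the shorter word.
    braid : ∀ b n → suc n ≡ m x y →
            ∃ λ e → letters (alternating b (suc (suc n))) ∼ e × length e ≡ n
    braid b n n+1≡m with alternating-split b (suc (suc n)) n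
    ... | w , l , e = reverse (letters w) , ++∼[]⇒∼reverse _ (letters w) trivial ,
                      ≡.trans (length-reverse (letters w)) (≡.trans (length-map letter w) l)
      where
      double : ∀ n → suc n ℕ.* 2 ≡ suc (suc n) ℕ.+ n
      double n = ≡.cong (suc ∘ suc) (≡.trans (ℕ.*-comm n 2) (≡.cong (n ℕ.+_) (ℕ.+-identityʳ n)))
      trivial : letters (alternating b (suc (suc n))) ++ letters w ∼ []
      trivial = begin
        letters (alternating b (suc (suc n))) ++ letters w
          ≡⟨ map-++ letter (alternating b (suc (suc n))) w ⟨
        letters (alternating b (suc (suc n)) ++ w)
          ≡⟨ ≡.cong letters e ⟨
        letters (alternating b (suc (suc n) ℕ.+ n))
          ≡⟨ ≡.cong (letters ∘ alternating b) (double n) ⟨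
        letters (alternating b (suc n ℕ.* 2))
          ≡⟨ relator-alternating b (suc n) ⟨
        concat (replicate (suc n) (letter b ∷ letter (not b) ∷ []))
          ≡⟨ ≡.cong (λ k → concat (replicate k (letter b ∷ letter (not b) ∷ [])))
               (≡.trans n+1≡m (≡.sym (m-letter b))) ⟩
        concat (replicate (m (letter b) (letter (not b))) (letter b ∷ letter (not b) ∷ []))
          ≈⟨ relator (letter b) (letter (not b)) ⟩
        [] ∎

    -- alternatingTo n is the alternating word of length n whose last letter is
    -- false; prolonged by true on the right, it starts with first n.
    first : ℕ → Bool
    first zero    = true
    first (suc n) = not (first n)

    alternatingTo : ℕ → List Bool
    alternatingTo zero    = []
    alternatingTo (suc n) = first (suc n) ∷ alternatingTo n

    alternatingTo-++ : ∀ n → alternatingTo n ++ [ true ] ≡ alternating (first n) (suc n)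
    alternatingTo-++ zero    = ≡.refl
    alternatingTo-++ (suc n) = ≡.cong (not (first n) ∷_)
      (≡.trans (alternatingTo-++ n)
               (≡.cong (λ b → alternating b (suc n)) (≡.sym (not-involutive (first n)))))

    length-alternatingTo : ∀ n → length (alternatingTo n) ≡ n
    length-alternatingTo zero    = ≡.refl
    length-alternatingTo (suc n) = ≡.cong suc (length-alternatingTo n)

    -- m x y = 0 encodes ∞.
    Below : ℕ → Set
    Below n = m x y ≡ 0 ⊎ n ℕ.< m x y

    -- The word is scanned from its right end, after which `x` stands. It stays alternating until
    -- either two equal letters meet and cancel, or its length reaches `m` and a braid relation
    -- shortens `dx`.
    alternating? : ∀ d → (∃ λ n → d ≡ alternatingTo n × Below n) ⊎
      (∃ λ e → letters d ++ [ x ] ∼ e × length e ℕ.< length d)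
    alternating? [] = inj₁ (0 , ≡.refl , below)
      where
      below : Below 0
      below with m x y
      ... | zero  = inj₁ ≡.refl
      ... | suc _ = inj₂ (s≤s z≤n)
    alternating? (b ∷ d) with alternating? d
    ... | inj₂ (e , d∼e , lt)        = inj₂ (letter b ∷ e , ++-congˡ [ letter b ] d∼e , s≤s lt)
    ... | inj₁ (n , ≡.refl , below) with b ≟ᵇ first (suc n)
    -- Here `b` is `true` and cancels against the final `x`.
    alternating? (b ∷ d) | inj₁ (zero , ≡.refl , below) | no b≢ with ¬-not b≢
    ... | ≡.refl = inj₂ ([] , xx∼[] x , s≤s z≤n)
    -- Here `b` repeats the first letter of `d` and cancels it.
    alternating? (b ∷ d) | inj₁ (suc n , ≡.refl , below) | no b≢ with ≡.trans (¬-not b≢) (not-involutive _)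
    ... | ≡.refl = inj₂ (letters (alternatingTo n) ++ [ x ]
                        , ++-congʳ _ (xx∼[] (letter b))
                        , ℕ.≤-reflexive (≡.cong suc (≡.trans (length-∷ʳ (letters (alternatingTo n)) x)
                            (≡.cong suc (length-map letter (alternatingTo n))))))
    alternating? (b ∷ d) | inj₁ (n , ≡.refl , inj₁ m≡0) | yes ≡.refl =
      inj₁ (suc n , ≡.refl , inj₁ m≡0)
    alternating? (b ∷ d) | inj₁ (n , ≡.refl , inj₂ n<m) | yes ≡.refl with suc n ℕ.≟ m x y
    ... | no  n+1≢m = inj₁ (suc n , ≡.refl , inj₂ (ℕ.≤∧≢⇒< n<m n+1≢m))
    -- The scanned word now has length `m`; followed by `x` it has length `m + 1` and equals a word
    -- of length `m - 1`.
    ... | yes n+1≡m with braid (first (suc n)) n n+1≡m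
    ...   | e , w∼e , l = inj₂ (e , ≡.subst (_∼ e) (≡.sym isAlternating) w∼e
                               , ℕ.≤-reflexive (≡.cong suc (≡.trans l (≡.sym (length-alternatingTo n)))))
      where
      isAlternating : letters (alternatingTo (suc n)) ++ [ x ]
                      ≡ letters (alternating (first (suc n)) (suc (suc n)))
      isAlternating = ≡.trans (≡.sym (map-++ letter (alternatingTo (suc n)) [ true ]))
                    (≡.cong letters (alternatingTo-++ (suc n)))

-- Ordered fields and signs of Chebyshev values.

module OrderedFieldProperties {f ℓ₁ ℓ₂} (F : OrderedField f ℓ₁ ℓ₂) where
  open OrderedField F
    using (IsTwoCos; two-cos-∞; two-cos-1; two-cos-m; cheb; commutativeRing;
           _≤_; isDecTotalOrder; +-monoˡ-≤; *-nonNeg; 0≉1; inverse)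
  open CommutativeRing commutativeRing hiding (zero)
  open RingProperties ring
  open IntegerCoefficients commutativeRing
  open SetoidReasoning setoid
  open IsDecTotalOrder isDecTotalOrder public
    using (total; antisym)
    renaming (≤-respʳ-≈ to ≤-respʳ; ≤-respˡ-≈ to ≤-respˡ; refl to ≤-refl;
              trans to ≤-trans; reflexive to ≤-reflexive)

  0≤+ : ∀ {a b} → 0# ≤ a → 0# ≤ b → 0# ≤ a + b
  0≤+ {a} {b} 0≤a 0≤b = ≤-trans 0≤b (≤-respˡ (+-identityˡ b) (+-monoˡ-≤ b 0≤a))

  ≤0⇒0≤- : ∀ {a} → a ≤ 0# → 0# ≤ - a
  ≤0⇒0≤- {a} a≤0 = ≤-respˡ (-‿inverseʳ a) (≤-respʳ (+-identityˡ (- a)) (+-monoˡ-≤ (- a) a≤0))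

  0≤-⇒≤0 : ∀ {a} → 0# ≤ - a → a ≤ 0#
  0≤-⇒≤0 {a} 0≤-a = ≤-respˡ (+-identityˡ a) (≤-respʳ (-‿inverseˡ a) (+-monoˡ-≤ a 0≤-a))

  0≤1 : 0# ≤ 1#
  0≤1 with total 0# 1#
  ... | inj₁ 0≤1 = 0≤1
  ... | inj₂ 1≤0 = ≤-respʳ (solve 0 ((:- :1) :* (:- :1) := :1) refl)
                           (*-nonNeg (≤0⇒0≤- 1≤0) (≤0⇒0≤- 1≤0))

  -- If 2 vanished, `1 = - 1` would be both nonnegative and nonpositive.
  half : ∃ λ h → (1# + 1#) * h ≈ 1#
  half = inverse (1# + 1#) λ 2≈0 →
    0≉1 (antisym 0≤1 (0≤-⇒≤0 (≤-respʳ (+-inverseʳ-unique 1# 1# 2≈0) 0≤1)))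

  -- For `t = 2`, the case `θ = 0`, the values are 0, 1, 2 and so on.
  cheb-two : ∀ {t} → t ≈ 1# + 1# → ∀ n → cheb t (suc n) ≈ cheb t n + 1#
  cheb-two t≈2 zero            = sym (+-identityˡ 1#)
  cheb-two {t} t≈2 (suc n) = begin
    t * b - a
      ≈⟨ +-congʳ (*-congʳ t≈2) ⟩
    (1# + 1#) * b - a
      ≈⟨ solve 2 (λ a b → (:1 :+ :1) :* b :- a := b :+ (b :- a)) refl a b ⟩
    b + (b - a)
      ≈⟨ +-congˡ (+-congʳ (cheb-two t≈2 n)) ⟩
    b + ((a + 1#) - a)
      ≈⟨ +-congˡ (solve 1 (λ a → (a :+ :1) :- a := :1) refl a) ⟩
    b + 1# ∎
    where
    a = cheb t n
    b = cheb t (suc n)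

  -- Two consecutive values are treated together because they will be the two coefficients of an
  -- alternating word applied to a simple root.
  cheb-nonNeg : ∀ {k t} → IsTwoCos k t → ∀ n → k ≡ 0 ⊎ n ℕ.< k → 0# ≤ cheb t n × 0# ≤ cheb t (suc n)
  cheb-nonNeg {t = t} (two-cos-∞ t≈2) n _ = nonNeg n , nonNeg (suc n)
    where
    nonNeg : ∀ n → 0# ≤ cheb t n
    nonNeg zero    = ≤-refl
    nonNeg (suc n) = ≤-respʳ (sym (cheb-two t≈2 n)) (0≤+ (nonNeg n) 0≤1)
  cheb-nonNeg (two-cos-1 _) zero    _ = ≤-refl , 0≤1
  cheb-nonNeg (two-cos-1 _) (suc n) (inj₂ (s≤s ()))
  cheb-nonNeg (two-cos-m () _ _) n (inj₁ ≡.refl)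
  cheb-nonNeg {k} {t} (two-cos-m _ ≈0 >0) n (inj₂ n<k) = nonNeg n (ℕ.<⇒≤ n<k) , nonNeg (suc n) n<k
    where
    nonNeg : ∀ n → n ℕ.≤ k → 0# ≤ cheb t n
    nonNeg zero    _   = ≤-refl
    nonNeg (suc n) n<k with suc n ℕ.≟ k
    -- The index may reach `k` itself, where the value is 0 instead of positive.
    ... | yes ≡.refl = ≤-reflexive (sym ≈0)
    ... | no  n≢k    = proj₁ (>0 (suc n) (s≤s z≤n) (ℕ.≤∧≢⇒< n<k n≢k))

-- The geometric representation: linear algebra on formal sums.

module Representation {s c ℓ f ℓ₁ ℓ₂}
                      (C : CoxeterSystem s c ℓ) (F : OrderedField f ℓ₁ ℓ₂)
                      (cosines : Cosines C F) where
  open CoxeterSystem C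
    using (S; matrix; m; m-sym; m≡1; _≟_; _∼_; ∼-refl; ∼-sym; ∼-trans; ∼-cong; relator)
  open OrderedField F
    using (K; IsTwoCos; two-cos-∞; two-cos-1; two-cos-m; cheb; commutativeRing;
           _≤_; *-nonNeg; 0≉1)
  open Cosines cosines
  open RootSystem C F cosines using (V; α; -ᵛ_; coeff; _≈ᵛ_; twoB; reflect; act)
  open Words matrix
  open OrderedFieldProperties F
  open CommutativeRing commutativeRing hiding (zero)
  open RingProperties ring
  open IntegerCoefficients commutativeRing
  open SetoidReasoning setoid

  -- The linear functional with values `g` on the basis. Coefficients, `twoB` and the invariant form
  -- are all of this kind, so linearity and compatibility with `_≈ᵛ_` are proved once.
  lin : (S → K) → V → K
  lin g []            = 0#
  lin g ((a , x) ∷ v) = a * g x + lin g v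

  lin-++ : ∀ g u v → lin g (u ++ v) ≈ lin g u + lin g v
  lin-++ g []            v = sym (+-identityˡ _)
  lin-++ g ((a , x) ∷ u) v = trans (+-congˡ (lin-++ g u v)) (sym (+-assoc _ _ _))

  infixr 7 _·_
  _·_ : K → V → V
  k · v = map (λ (a , x) → (k * a , x)) v

  lin-· : ∀ g k v → lin g (k · v) ≈ k * lin g v
  lin-· g k []            = sym (zeroʳ k)
  lin-· g k ((a , x) ∷ v) = begin
    k * a * g x + lin g (k · v) ≈⟨ +-cong (*-assoc k a (g x)) (lin-· g k v) ⟩
    k * (a * g x) + k * lin g v ≈⟨ distribˡ k _ _ ⟨
    k * (a * g x + lin g v)     ∎

  lin--ᵛ : ∀ g v → lin g (-ᵛ v) ≈ - lin g v
  lin--ᵛ g []            = sym -0#≈0#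
  lin--ᵛ g ((a , x) ∷ v) = begin
    - a * g x + lin g (-ᵛ v) ≈⟨ +-cong (sym (-‿distribˡ-* a (g x))) (lin--ᵛ g v) ⟩
    - (a * g x) - lin g v    ≈⟨ -‿+-comm _ _ ⟩
    - (a * g x + lin g v)    ∎

  lin-congˡ : ∀ {g h} → (∀ x → g x ≈ h x) → ∀ v → lin g v ≈ lin h v
  lin-congˡ g≈h []            = refl
  lin-congˡ g≈h ((a , x) ∷ v) = +-cong (*-congˡ (g≈h x)) (lin-congˡ g≈h v)

  δ : S → S → K
  δ y x with x ≟ y
  ... | yes _ = 1#
  ... | no  _ = 0#

  δ-refl : ∀ x → δ x x ≈ 1#
  δ-refl x with x ≟ x
  ... | yes _   = refl
  ... | no  x≢x = ⊥-elim (x≢x ≡.refl)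

  δ-≢ : ∀ {x y} → x ≢ y → δ y x ≈ 0#
  δ-≢ {x} {y} x≢y with x ≟ y
  ... | yes x≡y = ⊥-elim (x≢y x≡y)
  ... | no  _   = refl

  coeff≈lin : ∀ v y → coeff v y ≈ lin (δ y) v
  coeff≈lin []            y = refl
  coeff≈lin ((a , x) ∷ v) y with x ≟ y
  ... | yes _ = +-cong (sym (*-identityʳ a)) (coeff≈lin v y)
  ... | no  _ = trans (coeff≈lin v y) (sym (trans (+-congʳ (zeroʳ a)) (+-identityˡ _)))

  coeff-∷ : ∀ a x v y → coeff ((a , x) ∷ v) y ≈ a * δ y x + coeff v y
  coeff-∷ a x v y = trans (coeff≈lin ((a , x) ∷ v) y) (+-congˡ (sym (coeff≈lin v y)))

  coeff-++ : ∀ u v y → coeff (u ++ v) y ≈ coeff u y + coeff v y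
  coeff-++ u v y = trans (coeff≈lin (u ++ v) y)
    (trans (lin-++ (δ y) u v) (sym (+-cong (coeff≈lin u y) (coeff≈lin v y))))

  coeff-· : ∀ k v y → coeff (k · v) y ≈ k * coeff v y
  coeff-· k v y = trans (coeff≈lin (k · v) y)
    (trans (lin-· (δ y) k v) (*-congˡ (sym (coeff≈lin v y))))

  coeff--ᵛ : ∀ v y → coeff (-ᵛ v) y ≈ - coeff v y
  coeff--ᵛ v y = trans (coeff≈lin (-ᵛ v) y)
    (trans (lin--ᵛ (δ y) v) (-‿cong (sym (coeff≈lin v y))))

  coeff-α : ∀ x y → coeff (α x) y ≈ δ y x
  coeff-α x y = trans (coeff-∷ 1# x [] y) (trans (+-identityʳ _) (*-identityˡ _))

  𝕍 : Setoid _ _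
  𝕍 = record
    { Carrier       = V
    ; _≈_           = _≈ᵛ_
    ; isEquivalence = record
        { refl  = λ _ → refl
        ; sym   = λ e x → sym (e x)
        ; trans = λ e e′ x → trans (e x) (e′ x)
        }
    }
  module 𝕍 = Setoid 𝕍

  singleton≈· : ∀ k x → [ (k , x) ] ≈ᵛ k · α x
  singleton≈· k x y = trans (coeff-∷ k x [] y) (trans (+-congʳ (*-congʳ (sym (*-identityʳ k))))
    (sym (coeff-∷ (k * 1#) x [] y)))

  -ᵛ-cong : ∀ v v′ → v ≈ᵛ v′ → -ᵛ v ≈ᵛ -ᵛ v′
  -ᵛ-cong v v′ e y =
    trans (coeff--ᵛ v y) (trans (-‿cong (e y)) (sym (coeff--ᵛ v′ y)))

  -ᵛ-involutive : ∀ v → -ᵛ (-ᵛ v) ≈ᵛ v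
  -ᵛ-involutive v y = trans (coeff--ᵛ (-ᵛ v) y)
    (trans (-‿cong (coeff--ᵛ v y)) (-‿involutive _))

  remove : S → V → V
  remove y []            = []
  remove y ((a , x) ∷ v) with x ≟ y
  ... | yes _ = remove y v
  ... | no  _ = (a , x) ∷ remove y v

  length-remove : ∀ y v → length (remove y v) ℕ.≤ length v
  length-remove y []            = z≤n
  length-remove y ((a , x) ∷ v) with x ≟ y
  ... | yes _ = ℕ.m≤n⇒m≤1+n (length-remove y v)
  ... | no  _ = s≤s (length-remove y v)

  lin-remove : ∀ g y v → lin g v ≈ coeff v y * g y + lin g (remove y v)
  lin-remove g y []            = sym (trans (+-congʳ (zeroˡ _)) (+-identityˡ _))
  lin-remove g y ((a , x) ∷ v) with x ≟ y
  ... | yes ≡.refl = trans (+-congˡ (lin-remove g y v))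
    (solve 4 (λ a gx k r → a :* gx :+ (k :* gx :+ r) := (a :+ k) :* gx :+ r) refl
       a (g y) (coeff v y) (lin g (remove y v)))
  ... | no  _      = trans (+-congˡ (lin-remove g y v))
    (solve 5 (λ a gx k gy r → a :* gx :+ (k :* gy :+ r) := k :* gy :+ (a :* gx :+ r)) refl
       a (g x) (coeff v y) (g y) (lin g (remove y v)))

  coeff-remove : ∀ v → (∀ y → coeff v y ≈ 0#) → ∀ y z → coeff (remove y v) z ≈ 0#
  coeff-remove v v≈0 y z = begin
    coeff (remove y v) z                       ≈⟨ coeff≈lin (remove y v) z ⟩
    r                                          ≈⟨ +-identityˡ r ⟨
    0# + r                                     ≈⟨ +-congʳ (zeroˡ _) ⟨
    0# * δ z y + r                             ≈⟨ +-congʳ (*-congʳ (v≈0 y)) ⟨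
    coeff v y * δ z y + r                      ≈⟨ lin-remove (δ z) y v ⟨
    lin (δ z) v                                ≈⟨ coeff≈lin v z ⟨
    coeff v z                                  ≈⟨ v≈0 z ⟩
    0#                                         ∎
    where r = lin (δ z) (remove y v)

  -- Lists with equal coefficients need not be equal lists. Collecting all entries at the first
  -- letter splits off a multiple of a zero coefficient and leaves a shorter list; the bound `n`
  -- carries this induction on length.
  lin-zero : ∀ g n v → length v ℕ.≤ n → (∀ y → coeff v y ≈ 0#) → lin g v ≈ 0#
  lin-zero g n       []                _       _   = refl
  lin-zero g (suc n) v@((a , x) ∷ v′) (s≤s l) v≈0 = begin
    lin g v
      ≈⟨ lin-remove g x v ⟩
    coeff v x * g x + lin g (remove x v)
      ≈⟨ +-cong (*-congʳ (v≈0 x))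
                (lin-zero g n (remove x v) shorter (coeff-remove v v≈0 x)) ⟩
    0# * g x + 0#
      ≈⟨ trans (+-identityʳ _) (zeroˡ _) ⟩
    0# ∎
    where
    shorter : length (remove x v) ℕ.≤ n
    shorter with x ≟ x
    ... | yes _   = ℕ.≤-trans (length-remove x v′) l
    ... | no  x≢x = ⊥-elim (x≢x ≡.refl)

  lin-congʳ : ∀ g v v′ → v ≈ᵛ v′ → lin g v ≈ lin g v′
  lin-congʳ g v v′ e = x∙y⁻¹≈ε⇒x≈y _ _ (begin
    lin g v - lin g v′       ≈⟨ +-congˡ (lin--ᵛ g v′) ⟨
    lin g v + lin g (-ᵛ v′)  ≈⟨ lin-++ g v (-ᵛ v′) ⟨
    lin g (v ++ -ᵛ v′)       ≈⟨ lin-zero g _ (v ++ -ᵛ v′) ℕ.≤-refl (λ y → begin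
        coeff (v ++ -ᵛ v′) y       ≈⟨ coeff-++ v (-ᵛ v′) y ⟩
        coeff v y + coeff (-ᵛ v′) y ≈⟨ +-cong (e y) (coeff--ᵛ v′ y) ⟩
        coeff v′ y - coeff v′ y    ≈⟨ -‿inverseʳ _ ⟩
        0#                         ∎) ⟩
    0#                       ∎)

  -- Simple reflections.

  gram : S → S → K
  gram x y = - twoCos (m x y)

  twoB≡lin : ∀ x v → twoB x v ≡ lin (gram x) v
  twoB≡lin x []            = ≡.refl
  twoB≡lin x ((a , y) ∷ v) = ≡.cong (λ r → a * gram x y + r) (twoB≡lin x v)

  twoB≈lin : ∀ x v → twoB x v ≈ lin (gram x) v
  twoB≈lin x v = reflexive (twoB≡lin x v)

  twoB-cong : ∀ x v v′ → v ≈ᵛ v′ → twoB x v ≈ twoB x v′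
  twoB-cong x v v′ e = trans (twoB≈lin x v) (trans (lin-congʳ (gram x) v v′ e) (sym (twoB≈lin x v′)))

  twoB-++ : ∀ x u v → twoB x (u ++ v) ≈ twoB x u + twoB x v
  twoB-++ x u v = trans (twoB≈lin x (u ++ v))
    (trans (lin-++ (gram x) u v) (sym (+-cong (twoB≈lin x u) (twoB≈lin x v))))

  twoB-· : ∀ x k v → twoB x (k · v) ≈ k * twoB x v
  twoB-· x k v = trans (twoB≈lin x (k · v))
    (trans (lin-· (gram x) k v) (*-congˡ (sym (twoB≈lin x v))))

  -- Because `m x x = 1` and `2 cos π = - 2`.
  gram-diag : ∀ x → gram x x ≈ 1# + 1#
  gram-diag x = go (isTwoCos x x) (Equivalence.from (m≡1 x x) ≡.refl)
    where
    go : ∀ {n k} → IsTwoCos n k → n ≡ 1 → - k ≈ 1# + 1#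
    go (two-cos-∞ _)       ()
    go (two-cos-1 e)       _ = trans (-‿cong e) (-‿involutive _)
    go (two-cos-m (s≤s ()) _ _) ≡.refl

  coeff-reflect : ∀ x v y → coeff (reflect x v) y ≈ - twoB x v * δ y x + coeff v y
  coeff-reflect x v y = coeff-∷ (- twoB x v) x v y

  reflect-cong : ∀ x v v′ → v ≈ᵛ v′ → reflect x v ≈ᵛ reflect x v′
  reflect-cong x v v′ e y = begin
    coeff (reflect x v) y               ≈⟨ coeff-reflect x v y ⟩
    - twoB x v * δ y x + coeff v y      ≈⟨ +-cong (*-congʳ (-‿cong (twoB-cong x v v′ e))) (e y) ⟩
    - twoB x v′ * δ y x + coeff v′ y    ≈⟨ coeff-reflect x v′ y ⟨
    coeff (reflect x v′) y              ∎

  reflect-++ : ∀ x u v → reflect x (u ++ v) ≈ᵛ reflect x u ++ reflect x v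
  reflect-++ x u v y = begin
    coeff (reflect x (u ++ v)) y
      ≈⟨ coeff-reflect x (u ++ v) y ⟩
    - twoB x (u ++ v) * δ y x + coeff (u ++ v) y
      ≈⟨ +-cong (*-congʳ (-‿cong (twoB-++ x u v))) (coeff-++ u v y) ⟩
    - (twoB x u + twoB x v) * δ y x + (coeff u y + coeff v y)
      ≈⟨ solve 5 (λ p q d a b → (:- (p :+ q)) :* d :+ (a :+ b)
                                 := ((:- p) :* d :+ a) :+ ((:- q) :* d :+ b)) refl
           (twoB x u) (twoB x v) (δ y x) (coeff u y) (coeff v y) ⟩
    (- twoB x u * δ y x + coeff u y) + (- twoB x v * δ y x + coeff v y)
      ≈⟨ +-cong (coeff-reflect x u y) (coeff-reflect x v y) ⟨
    coeff (reflect x u) y + coeff (reflect x v) y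
      ≈⟨ coeff-++ (reflect x u) (reflect x v) y ⟨
    coeff (reflect x u ++ reflect x v) y ∎

  reflect-· : ∀ x k v → reflect x (k · v) ≈ᵛ k · reflect x v
  reflect-· x k v y = begin
    coeff (reflect x (k · v)) y
      ≈⟨ coeff-reflect x (k · v) y ⟩
    - twoB x (k · v) * δ y x + coeff (k · v) y
      ≈⟨ +-cong (*-congʳ (-‿cong (twoB-· x k v))) (coeff-· k v y) ⟩
    - (k * twoB x v) * δ y x + k * coeff v y
      ≈⟨ solve 4 (λ k p d a → (:- (k :* p)) :* d :+ k :* a := k :* ((:- p) :* d :+ a)) refl
           k (twoB x v) (δ y x) (coeff v y) ⟩
    k * (- twoB x v * δ y x + coeff v y)
      ≈⟨ *-congˡ (coeff-reflect x v y) ⟨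
    k * coeff (reflect x v) y
      ≈⟨ coeff-· k (reflect x v) y ⟨
    coeff (k · reflect x v) y ∎

  act-cong : ∀ u v v′ → v ≈ᵛ v′ → act u v ≈ᵛ act u v′
  act-cong []      v v′ e = e
  act-cong (x ∷ u) v v′ e = reflect-cong x (act u v) (act u v′) (act-cong u v v′ e)

  act-++ : ∀ u v w → act u (v ++ w) ≈ᵛ act u v ++ act u w
  act-++ []      v w = 𝕍.refl {v ++ w}
  act-++ (x ∷ u) v w y = trans
    (reflect-cong x (act u (v ++ w)) (act u v ++ act u w) (act-++ u v w) y)
    (reflect-++ x (act u v) (act u w) y)

  act-· : ∀ u k v → act u (k · v) ≈ᵛ k · act u v
  act-· []      k v = 𝕍.refl {k · v}
  act-· (x ∷ u) k v y = trans
    (reflect-cong x (act u (k · v)) (k · act u v) (act-· u k v) y)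
    (reflect-· x k (act u v) y)

  -ᵛ≈-1· : ∀ v → -ᵛ v ≈ᵛ (- 1#) · v
  -ᵛ≈-1· v y = trans (coeff--ᵛ v y) (sym (trans (coeff-· (- 1#) v y) (-1*x≈-x _)))

  act--ᵛ : ∀ u v → act u (-ᵛ v) ≈ᵛ -ᵛ act u v
  act--ᵛ u v y = begin
    coeff (act u (-ᵛ v)) y       ≈⟨ act-cong u (-ᵛ v) ((- 1#) · v) (-ᵛ≈-1· v) y ⟩
    coeff (act u ((- 1#) · v)) y ≈⟨ act-· u (- 1#) v y ⟩
    coeff ((- 1#) · act u v) y   ≈⟨ -ᵛ≈-1· (act u v) y ⟨
    coeff (-ᵛ act u v) y         ∎

  act-concat : ∀ u w v → act (u ++ w) v ≈ᵛ act u (act w v)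
  act-concat u w v y = reflexive (≡.cong (λ r → coeff r y) (foldr-++ reflect v u w))

  -- The Coxeter relations hold for the reflections.

  reflect-involutive : ∀ x v → reflect x (reflect x v) ≈ᵛ v
  reflect-involutive x v y = begin
    coeff (reflect x (reflect x v)) y
      ≈⟨ coeff-reflect x (reflect x v) y ⟩
    - (- p * gram x x + p) * δ y x + coeff (reflect x v) y
      ≈⟨ +-cong (*-congʳ (-‿cong (+-congʳ (*-congˡ (gram-diag x))))) (coeff-reflect x v y) ⟩
    - (- p * (1# + 1#) + p) * δ y x + (- p * δ y x + coeff v y)
      ≈⟨ solve 3 (λ p d a → (:- ((:- p) :* (:1 :+ :1) :+ p)) :* d :+ ((:- p) :* d :+ a) := a) refl
           p (δ y x) (coeff v y) ⟩
    coeff v y ∎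
    where p = twoB x v

  -- This is `sin² kθ + sin² (k+1)θ - 2 cos θ sin kθ sin (k+1)θ = sin² θ`, divided by `sin² θ`. The
  -- recurrence leaves the left side unchanged when `k` grows by 1.
  cheb-invariant : ∀ t k → cheb t k * cheb t k + cheb t (suc k) * cheb t (suc k)
                           - t * cheb t k * cheb t (suc k) ≈ 1#
  cheb-invariant t zero    =
    solve 1 (λ t → :0 :* :0 :+ :1 :* :1 :- t :* :0 :* :1 := :1) refl t
  cheb-invariant t (suc k) = trans
    (solve 3 (λ t a b → b :* b :+ (t :* b :- a) :* (t :* b :- a) :- t :* b :* (t :* b :- a)
                        := a :* a :+ b :* b :- t :* a :* b) refl
       t (cheb t k) (cheb t (suc k)))
    (cheb-invariant t k)

  gram-sym : ∀ x y → gram y x ≡ gram x y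
  gram-sym x y = ≡.cong (λ n → - twoCos n) (m-sym y x)

  -- The coefficients of α y and α x are the sums of sin (jθ) / sin θ, for j of
  -- one parity, that a rotation by 2kθ produces; both vanish with sin (kθ).
  act-rotation : ∀ x y k v →
    let t = twoCos (m x y); a = cheb t k; b = cheb t (suc k)
        p = twoB y v; q = twoB x v in
    act (concat (replicate k (x ∷ y ∷ []))) v ≈ᵛ
      (- (a * (a * p + (t * a - b) * q)) , y) ∷ (- (a * (b * p + a * q)) , x) ∷ v
  act-rotation x y zero v z = sym (begin
    coeff ((_ , y) ∷ (_ , x) ∷ v) z
      ≈⟨ coeff-∷ _ y ((_ , x) ∷ v) z ⟩
    _ * δ z y + coeff ((_ , x) ∷ v) z
      ≈⟨ +-congˡ (coeff-∷ _ x v z) ⟩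
    - (0# * (0# * p + (t * 0# - 1#) * q)) * δ z y + (- (0# * (1# * p + 0# * q)) * δ z x + coeff v z)
      ≈⟨ solve 6 (λ t p q d e r →
           (:- (:0 :* (:0 :* p :+ (t :* :0 :- :1) :* q))) :* d
             :+ ((:- (:0 :* (:1 :* p :+ :0 :* q))) :* e :+ r) := r) refl
           t p q (δ z y) (δ z x) (coeff v z) ⟩
    coeff v z ∎)
    where
    t = twoCos (m x y)
    p = twoB y v
    q = twoB x v
  act-rotation x y (suc k) v z = begin
    coeff (reflect x (reflect y w)) z
      ≈⟨ reflect-cong x (reflect y w) (reflect y w′) (reflect-cong y w w′ (act-rotation x y k v)) z ⟩
    coeff (reflect x (reflect y w′)) z
      ≈⟨ trans (coeff-reflect x (reflect y w′) z) (+-congˡ (coeff-reflect y w′ z)) ⟩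
    - twoB x (reflect y w′) * δ z x + (- twoB y w′ * δ z y + coeff w′ z)
      ≈⟨ +-cong (*-congʳ (-‿cong (+-cong (*-congʳ (-‿cong p′≈)) q′≈)))
           (+-cong (*-congʳ (-‿cong p′≈))
                   (trans (coeff-∷ _ y _ z) (+-congˡ (coeff-∷ _ x v z)))) ⟩
    - (- p′ * - t + q′) * δ z x + (- p′ * δ z y + (- X * δ z y + (- Y * δ z x + coeff v z)))
      ≈⟨ regroup p′ t q′ (δ z x) (δ z y) X Y (coeff v z) ⟩
    - (p′ + X) * δ z y + (- (p′ * t + q′ + Y) * δ z x + coeff v z)
      ≈⟨ +-cong (*-congʳ (-‿cong X-step)) (+-congʳ (*-congʳ (-‿cong Y-step))) ⟩
    - X⁺ * δ z y + (- Y⁺ * δ z x + coeff v z)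
      ≈⟨ trans (coeff-∷ _ y _ z) (+-congˡ (coeff-∷ _ x v z)) ⟨
    coeff ((- X⁺ , y) ∷ (- Y⁺ , x) ∷ v) z ∎
    where
    t = twoCos (m x y)
    a = cheb t k
    b = cheb t (suc k)
    p = twoB y v
    q = twoB x v
    -- The factor `t * a - b` is the Chebyshev value before `a`, written so that no index `k - 1` is
    -- needed.
    X = a * (a * p + (t * a - b) * q)
    Y = a * (b * p + a * q)
    w = act (concat (replicate k (x ∷ y ∷ []))) v
    w′ = (- X , y) ∷ (- Y , x) ∷ v
    -- At `k + 1`, `b` and `b⁺` take the places of `a` and `b`, which turns `X` and `Y` into `X⁺`
    -- and `Y⁺`.
    b⁺ = t * b - a
    X⁺ = b * (b * p + (t * b - b⁺) * q)
    Y⁺ = b * (b⁺ * p + b * q)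
    p′ = - X * (1# + 1#) + (- Y * - t + p)
    q′ = - X * - t + (- Y * (1# + 1#) + q)
    p′≈ : twoB y w′ ≈ p′
    p′≈ = +-cong (*-congˡ (gram-diag y)) (+-congʳ (*-congˡ (reflexive (gram-sym x y))))
    q′≈ : twoB x w′ ≈ q′
    q′≈ = +-congˡ (+-congʳ (*-congˡ (gram-diag x)))
    regroup : ∀ p′ t q′ d e X Y r →
      - (- p′ * - t + q′) * d + (- p′ * e + (- X * e + (- Y * d + r)))
      ≈ - (p′ + X) * e + (- (p′ * t + q′ + Y) * d + r)
    regroup = solve 8 (λ p′ t q′ d e X Y r →
      (:- ((:- p′) :* (:- t) :+ q′)) :* d :+ ((:- p′) :* e :+ ((:- X) :* e :+ ((:- Y) :* d :+ r)))
      := (:- (p′ :+ X)) :* e :+ ((:- (p′ :* t :+ q′ :+ Y)) :* d :+ r)) refl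
    -- `X` and `Y` are quadratic in `a` and `b`, but `p` and `q` also occur bare in `p′` and `q′`.
    -- Multiplying the bare terms by `I`, which equals 1, makes both steps polynomial identities.
    I = a * a + b * b - t * a * b
    scale : ∀ r → r ≈ I * r
    scale r = sym (trans (*-congʳ (cheb-invariant t k)) (*-identityˡ r))
    X-step : p′ + X ≈ X⁺
    X-step = begin
      p′ + X
        ≈⟨ +-congʳ (+-congˡ (+-congˡ (scale p))) ⟩
      - X * (1# + 1#) + (- Y * - t + I * p) + X
        ≈⟨ solve 5 (λ t a b p q →
             let X = a :* (a :* p :+ (t :* a :- b) :* q)
                 Y = a :* (b :* p :+ a :* q)
                 I = a :* a :+ b :* b :- t :* a :* b in
             (:- X) :* (:1 :+ :1) :+ ((:- Y) :* (:- t) :+ I :* p) :+ X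
             := b :* (b :* p :+ (t :* b :- (t :* b :- a)) :* q)) refl t a b p q ⟩
      X⁺ ∎
    Y-step : p′ * t + q′ + Y ≈ Y⁺
    Y-step = begin
      p′ * t + q′ + Y
        ≈⟨ +-congʳ (+-cong (*-congʳ (+-congˡ (+-congˡ (scale p)))) (+-congˡ (+-congˡ (scale q)))) ⟩
      (- X * (1# + 1#) + (- Y * - t + I * p)) * t + (- X * - t + (- Y * (1# + 1#) + I * q)) + Y
        ≈⟨ solve 5 (λ t a b p q →
             let X = a :* (a :* p :+ (t :* a :- b) :* q)
                 Y = a :* (b :* p :+ a :* q)
                 I = a :* a :+ b :* b :- t :* a :* b in
             ((:- X) :* (:1 :+ :1) :+ ((:- Y) :* (:- t) :+ I :* p)) :* t
               :+ ((:- X) :* (:- t) :+ ((:- Y) :* (:1 :+ :1) :+ I :* q)) :+ Y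
             := b :* ((t :* b :- a) :* p :+ b :* q)) refl t a b p q ⟩
      Y⁺ ∎

  -- For `m = 0` the relator is empty, for `m = 1` it is `x x`, and for `m ≥ 2` both corrections in
  -- `act-rotation` carry the factor `cheb t m = 0`.
  act-relator : ∀ x y v → act (concat (replicate (m x y) (x ∷ y ∷ []))) v ≈ᵛ v
  act-relator x y v = go (isTwoCos x y) ≡.refl ≡.refl
    where
    go : ∀ {n k} → IsTwoCos n k → n ≡ m x y → k ≡ twoCos (m x y) →
         act (concat (replicate n (x ∷ y ∷ []))) v ≈ᵛ v
    go (two-cos-∞ _)     _ _ = 𝕍.refl {v}
    go (two-cos-1 _)     e _ with Equivalence.to (m≡1 x y) (≡.sym e)
    ... | ≡.refl = reflect-involutive x v
    go {n} (two-cos-m _ a≈0 _) _ ≡.refl z = begin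
      coeff (act (concat (replicate n (x ∷ y ∷ []))) v) z
        ≈⟨ act-rotation x y n v z ⟩
      coeff ((- (a * _) , y) ∷ (- (a * _) , x) ∷ v) z
        ≈⟨ trans (coeff-∷ _ y _ z) (+-congˡ (coeff-∷ _ x v z)) ⟩
      - (a * _) * δ z y + (- (a * _) * δ z x + coeff v z)
        ≈⟨ +-cong (*-congʳ (-‿cong (*-congʳ a≈0))) (+-congʳ (*-congʳ (-‿cong (*-congʳ a≈0)))) ⟩
      - (0# * X) * δ z y + (- (0# * Y) * δ z x + coeff v z)
        ≈⟨ solve 5 (λ d e X Y r → (:- (:0 :* X)) :* d :+ ((:- (:0 :* Y)) :* e :+ r) := r) refl
             (δ z y) (δ z x) X Y (coeff v z) ⟩
      coeff v z ∎
      where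
      t = twoCos (m x y)
      a = cheb t n
      b = cheb t (suc n)
      p = twoB y v
      q = twoB x v
      X = a * p + (t * a - b) * q
      Y = b * p + a * q

  act-∼ : ∀ {u u′} → u ∼ u′ → ∀ v → act u v ≈ᵛ act u′ v
  act-∼ {u} ∼-refl v = 𝕍.refl {act u v}
  act-∼ (∼-sym {u} {u′} e) v = 𝕍.sym {act u v} {act u′ v} (act-∼ e v)
  act-∼ (∼-trans {u} {u′} {u″} e e′) v =
    𝕍.trans {act u v} {act u′ v} {act u″ v} (act-∼ e v) (act-∼ e′ v)
  act-∼ (∼-cong {u} {u′} {w} {w′} e e′) v z = begin
    coeff (act (u ++ w) v) z     ≈⟨ act-concat u w v z ⟩
    coeff (act u (act w v)) z    ≈⟨ act-cong u (act w v) (act w′ v) (act-∼ e′ v) z ⟩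
    coeff (act u (act w′ v)) z   ≈⟨ act-∼ e (act w′ v) z ⟩
    coeff (act u′ (act w′ v)) z  ≈⟨ act-concat u′ w′ v z ⟨
    coeff (act (u′ ++ w′) v) z   ∎
  act-∼ (relator x y) v = act-relator x y v

  -- The invariant bilinear form `2 B`.

  form : V → V → K
  form v w = lin (λ x → twoB x w) v

  form-congʳ : ∀ u v v′ → v ≈ᵛ v′ → form u v ≈ form u v′
  form-congʳ u v v′ e = lin-congˡ (λ x → twoB-cong x v v′ e) u

  form-cong : ∀ u u′ v v′ → u ≈ᵛ u′ → v ≈ᵛ v′ → form u v ≈ form u′ v′
  form-cong u u′ v v′ e e′ =
    trans (lin-congʳ (λ x → twoB x v) u u′ e) (form-congʳ u′ v v′ e′)

  -- The symmetry of `gram` enters here: `form` unfolds in its first argument, and this unfolds it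
  -- in the second.
  form-∷ʳ : ∀ u a x v → form u ((a , x) ∷ v) ≈ a * twoB x u + form u v
  form-∷ʳ []            a x v = sym (trans (+-identityʳ _) (zeroʳ a))
  form-∷ʳ ((b , y) ∷ u) a x v = begin
    b * (a * gram y x + twoB y v) + form u ((a , x) ∷ v)
      ≈⟨ +-cong (*-congˡ (+-congʳ (*-congˡ (reflexive (gram-sym x y))))) (form-∷ʳ u a x v) ⟩
    b * (a * gram x y + twoB y v) + (a * twoB x u + form u v)
      ≈⟨ solve 6 (λ b a g r t w → b :* (a :* g :+ r) :+ (a :* t :+ w)
                                   := a :* (b :* g :+ t) :+ (b :* r :+ w)) refl
           b a (gram x y) (twoB y v) (twoB x u) (form u v) ⟩
    a * (b * gram x y + twoB x u) + (b * twoB y v + form u v) ∎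

  form-reflect : ∀ x u v → form (reflect x u) (reflect x v) ≈ form u v
  form-reflect x u v = begin
    - p * (- q * gram x x + q) + form u (reflect x v)
      ≈⟨ +-cong (*-congˡ (+-congʳ (*-congˡ (gram-diag x)))) (form-∷ʳ u (- q) x v) ⟩
    - p * (- q * (1# + 1#) + q) + (- q * p + form u v)
      ≈⟨ solve 3 (λ p q r → (:- p) :* ((:- q) :* (:1 :+ :1) :+ q) :+ ((:- q) :* p :+ r) := r) refl
           p q (form u v) ⟩
    form u v ∎
    where
    p = twoB x u
    q = twoB x v

  form-act : ∀ u v w → form (act u v) (act u w) ≈ form v w
  form-act []      v w = refl
  form-act (x ∷ u) v w = trans (form-reflect x (act u v) (act u w)) (form-act u v w)

  form-α : ∀ x v → form (α x) v ≈ twoB x v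
  form-α x v = trans (+-identityʳ _) (*-identityˡ _)

  -- Nonnegative vectors.

  NonNeg : V → Set _
  NonNeg v = ∀ y → 0# ≤ coeff v y

  NonNeg-resp : ∀ v w → v ≈ᵛ w → NonNeg v → NonNeg w
  NonNeg-resp v w e 0≤v y = ≤-respʳ (e y) (0≤v y)

  NonNeg-α : ∀ x → NonNeg (α x)
  NonNeg-α x y = ≤-respʳ (sym (coeff-α x y)) 0≤δ
    where
    0≤δ : 0# ≤ δ y x
    0≤δ with x ≟ y
    ... | yes _ = 0≤1
    ... | no  _ = ≤-refl

  -α-not-NonNeg : ∀ x → ¬ NonNeg (-ᵛ α x)
  -α-not-NonNeg x 0≤-α = 0≉1 (antisym 0≤1 (0≤-⇒≤0 (≤-respʳ
    (trans (coeff--ᵛ (α x) x) (-‿cong (trans (coeff-α x x) (δ-refl x)))) (0≤-α x))))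

  NonNeg-combination : ∀ u {a b x y} → NonNeg (act u (α x)) → NonNeg (act u (α y)) →
                       0# ≤ a → 0# ≤ b → NonNeg (act u ((a , x) ∷ (b , y) ∷ []))
  NonNeg-combination u {a} {b} {x} {y} 0≤x 0≤y 0≤a 0≤b z = ≤-respʳ (sym eq)
    (0≤+ (*-nonNeg 0≤a (0≤x z)) (*-nonNeg 0≤b (0≤y z)))
    where
    part : ∀ k x → coeff (act u ((k , x) ∷ [])) z ≈ k * coeff (act u (α x)) z
    part k x = begin
      coeff (act u ((k , x) ∷ [])) z ≈⟨ act-cong u _ (k · α x) (singleton≈· k x) z ⟩
      coeff (act u (k · α x)) z      ≈⟨ act-· u k (α x) z ⟩
      coeff (k · act u (α x)) z      ≈⟨ coeff-· k (act u (α x)) z ⟩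
      k * coeff (act u (α x)) z      ∎
    eq : coeff (act u ((a , x) ∷ (b , y) ∷ [])) z ≈ a * coeff (act u (α x)) z + b * coeff (act u (α y)) z
    eq = begin
      coeff (act u ((a , x) ∷ (b , y) ∷ [])) z
        ≈⟨ act-++ u ((a , x) ∷ []) ((b , y) ∷ []) z ⟩
      coeff (act u ((a , x) ∷ []) ++ act u ((b , y) ∷ [])) z
        ≈⟨ coeff-++ (act u ((a , x) ∷ [])) _ z ⟩
      coeff (act u ((a , x) ∷ [])) z + coeff (act u ((b , y) ∷ [])) z
        ≈⟨ +-cong (part a x) (part b y) ⟩
      a * coeff (act u (α x)) z + b * coeff (act u (α y)) z ∎

  -- Dihedral subgroups: nonnegativity or descent.

  module DihedralAction (x y : S) where
    open Dihedral x y public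

    -- Reflecting in the letter `q` replaces its coefficient `a` by `t * b - a`, which is the
    -- Chebyshev recurrence.
    act-alternating : ∀ n → let t = twoCos (m x y) in
      act (letters (alternatingTo n)) (α x) ≈ᵛ
        (cheb t (suc n) , letter (first n)) ∷ (cheb t n , letter (not (first n))) ∷ []
    act-alternating zero    z = sym (trans (coeff-∷ 1# x _ z)
      (trans (+-congˡ (trans (coeff-∷ 0# y [] z) (trans (+-congʳ (zeroˡ _)) (+-identityˡ _))))
             (sym (coeff-∷ 1# x [] z))))
    act-alternating (suc n) z = begin
      coeff (reflect q (act (letters (alternatingTo n)) (α x))) z
        ≈⟨ reflect-cong q (act (letters (alternatingTo n)) (α x)) w (act-alternating n) z ⟩
      coeff (reflect q w) z
        ≈⟨ trans (coeff-reflect q w z) (+-congˡ (trans (coeff-∷ b p _ z) (+-congˡ (coeff-∷ a q [] z)))) ⟩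
      - (b * gram q p + (a * gram q q + 0#)) * δ z q + (b * δ z p + (a * δ z q + 0#))
        ≈⟨ +-congʳ (*-congʳ (-‿cong (+-cong (*-congˡ gram-qp) (+-congʳ (*-congˡ (gram-diag q)))))) ⟩
      - (b * - t + (a * (1# + 1#) + 0#)) * δ z q + (b * δ z p + (a * δ z q + 0#))
        ≈⟨ solve 5 (λ t a b d e →
             (:- (b :* (:- t) :+ (a :* (:1 :+ :1) :+ :0))) :* d :+ (b :* e :+ (a :* d :+ :0))
             := (t :* b :- a) :* d :+ (b :* e :+ :0)) refl t a b (δ z q) (δ z p) ⟩
      (t * b - a) * δ z q + (b * δ z p + 0#)
        ≈⟨ trans (coeff-∷ (t * b - a) q _ z) (+-congˡ (coeff-∷ b p [] z)) ⟨
      coeff ((t * b - a , q) ∷ (b , p) ∷ []) z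
        ≡⟨ ≡.cong (λ c → coeff ((t * b - a , q) ∷ (b , letter c) ∷ []) z)
             (≡.sym (not-involutive (first n))) ⟩
      coeff ((t * b - a , q) ∷ (b , letter (not (not (first n)))) ∷ []) z ∎
      where
      t = twoCos (m x y)
      a = cheb t n
      b = cheb t (suc n)
      p = letter (first n)
      q = letter (not (first n))
      w = (b , p) ∷ (a , q) ∷ []
      gram-qp : gram q p ≈ - t
      gram-qp = reflexive (≡.cong (λ k → - twoCos k)
        (≡.trans (m-sym q p) (m-letter (first n))))

    -- Since `v` and `d` together are no longer than `u`, shortening `dx` gives a descent of `u`
    -- even when `u` is not reduced.
    NonNeg-or-descent : ∀ u v d → u ∼ v ++ letters d →
      length v ℕ.+ length d ℕ.≤ length u → (∀ b → NonNeg (act v (α (letter b)))) →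
      NonNeg (act u (α x)) ⊎ Descent u x
    NonNeg-or-descent u v d u∼vd l 0≤ with alternating? d
    ... | inj₁ (n , ≡.refl , below) =
      inj₁ (NonNeg-resp (act v w) (act u (α x)) (λ z → sym (eq z))
             (NonNeg-combination v (0≤ (first n)) (0≤ (not (first n))) (proj₂ 0≤ab) (proj₁ 0≤ab)))
      where
      a = cheb (twoCos (m x y)) n
      b = cheb (twoCos (m x y)) (suc n)
      0≤ab = cheb-nonNeg (isTwoCos x y) n below
      w = (b , letter (first n)) ∷ (a , letter (not (first n))) ∷ []
      eq : act u (α x) ≈ᵛ act v w
      eq z = begin
        coeff (act u (α x)) z                    ≈⟨ act-∼ u∼vd (α x) z ⟩
        coeff (act (v ++ letters d) (α x)) z     ≈⟨ act-concat v (letters d) (α x) z ⟩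
        coeff (act v (act (letters d) (α x))) z  ≈⟨ act-cong v _ w (act-alternating n) z ⟩
        coeff (act v w) z                        ∎
    ... | inj₂ (e , dx∼e , lt) = inj₂ (v ++ e , ux∼ve , shorter)
      where
      ux∼ve : u ++ [ x ] ∼ v ++ e
      ux∼ve = ∼-trans (++-congʳ [ x ] u∼vd)
        (≡.subst (_∼ v ++ e) (≡.sym (++-assoc v (letters d) [ x ])) (++-congˡ v dx∼e))
      shorter : length (v ++ e) ℕ.< length u
      shorter = ℕ.≤-trans (ℕ.≤-reflexive (≡.cong suc (length-++ v)))
        (ℕ.≤-trans (ℕ.+-monoʳ-< (length v) lt) l)

    Stripped : List S → List Bool → Set _
    Stripped v d = ∃₂ λ v′ d′ → v ++ letters d ∼ v′ ++ letters d′ ×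
      length v′ ℕ.+ length d′ ℕ.≤ length v ℕ.+ length d × (∀ b → NonNeg (act v′ (α (letter b))))

    strip : ∀ k → (∀ v z → length v ℕ.≤ k → NonNeg (act v (α z)) ⊎ Descent v z) →
            ∀ v d → length v ℕ.≤ k → Stripped v d
    shift : ∀ k → (∀ v z → length v ℕ.≤ k → NonNeg (act v (α z)) ⊎ Descent v z) →
            ∀ v d b → length v ℕ.≤ k → Descent v (letter b) → Stripped v d

    -- A descent of v at letter b moves that letter from v to d, without making
    -- the total length grow.
    strip k IH v d l with IH v x l | IH v y l
    ... | inj₁ 0≤x | inj₁ 0≤y  = v , d , ∼-refl , ℕ.≤-refl , λ { true → 0≤x ; false → 0≤y }
    ... | inj₂ desc | _        = shift k IH v d true l desc
    ... | inj₁ _   | inj₂ desc = shift k IH v d false l desc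

    shift zero    IH v d b l (v₁ , e , lt) with ℕ.≤-trans lt l
    ... | ()
    shift (suc k) IH v d b l (v₁ , e , lt)
      with strip k (λ v z l → IH v z (ℕ.m≤n⇒m≤1+n l)) v₁ (b ∷ d) (ℕ.≤-pred (ℕ.≤-trans lt l))
    ... | v′ , d′ , e′ , l′ , 0≤ = v′ , d′ ,
      ∼-trans (≡.subst (v ++ letters d ∼_) (++-assoc v₁ [ letter b ] (letters d))
                 (++-congʳ (letters d) (++[]∼⇒∼++[] v v₁ (letter b) e))) e′ ,
      ℕ.≤-trans l′ (ℕ.≤-trans (ℕ.≤-reflexive (ℕ.+-suc (length v₁) (length d)))
                              (ℕ.+-monoˡ-≤ (length d) lt)) , 0≤

  -- Humphreys, Reflection Groups and Coxeter Groups, Theorem 5.4, without the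
  -- assumption that the word is reduced.
  positive-or-descent : ∀ n u x → length u ℕ.≤ n → NonNeg (act u (α x)) ⊎ Descent u x
  positive-or-descent n u x l with initLast u
  positive-or-descent n       .[]          x l | []      = inj₁ (NonNeg-α x)
  positive-or-descent zero    .(v ++ [ y ]) x l | v ∷ʳ′ y
    with ≡.subst (ℕ._≤ 0) (length-∷ʳ v y) l
  ... | ()
  positive-or-descent (suc n) .(v ++ [ y ]) x l | v ∷ʳ′ y =
    -- Stripping starts with `d = y`, so that `v` is shorter than `u` and the induction hypothesis
    -- covers it.
    let v′ , d , e , l′ , 0≤ = strip n (positive-or-descent n) v [ false ]
          (ℕ.≤-pred (≡.subst (ℕ._≤ suc n) (length-∷ʳ v y) l))
    in NonNeg-or-descent (v ++ [ y ]) v′ d e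
         (ℕ.≤-trans l′ (ℕ.≤-reflexive (≡.sym (length-++ v)))) 0≤
    where open DihedralAction x y

  -- Signs of roots and faithfulness.

  reflect-α : ∀ x → reflect x (α x) ≈ᵛ -ᵛ α x
  reflect-α x y = begin
    coeff (reflect x (α x)) y
      ≈⟨ trans (coeff-reflect x (α x) y) (+-congˡ (coeff-α x y)) ⟩
    - (1# * gram x x + 0#) * δ y x + δ y x
      ≈⟨ +-congʳ (*-congʳ (-‿cong (+-congʳ (*-congˡ (gram-diag x))))) ⟩
    - (1# * (1# + 1#) + 0#) * δ y x + δ y x
      ≈⟨ solve 1 (λ d → (:- (:1 :* (:1 :+ :1) :+ :0)) :* d :+ d := :- d) refl (δ y x) ⟩
    - δ y x
      ≈⟨ trans (coeff--ᵛ (α x) y) (-‿cong (coeff-α x y)) ⟨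
    coeff (-ᵛ α x) y ∎

  act-∷ʳ-α : ∀ u x → act (u ++ [ x ]) (α x) ≈ᵛ -ᵛ act u (α x)
  act-∷ʳ-α u x y = begin
    coeff (act (u ++ [ x ]) (α x)) y   ≈⟨ act-concat u [ x ] (α x) y ⟩
    coeff (act u (reflect x (α x))) y  ≈⟨ act-cong u (reflect x (α x)) (-ᵛ α x) (reflect-α x) y ⟩
    coeff (act u (-ᵛ α x)) y           ≈⟨ act--ᵛ u (α x) y ⟩
    coeff (-ᵛ act u (α x)) y           ∎

  act-α≈-ᵛ : ∀ u {u′} x → u ++ [ x ] ∼ u′ → act u (α x) ≈ᵛ -ᵛ act u′ (α x)
  act-α≈-ᵛ u {u′} x e y = begin
    coeff (act u (α x)) y
      ≈⟨ -ᵛ-involutive (act u (α x)) y ⟨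
    coeff (-ᵛ (-ᵛ act u (α x))) y
      ≈⟨ -ᵛ-cong (act (u ++ [ x ]) (α x)) (-ᵛ act u (α x)) (act-∷ʳ-α u x) y ⟨
    coeff (-ᵛ act (u ++ [ x ]) (α x)) y
      ≈⟨ -ᵛ-cong (act (u ++ [ x ]) (α x)) (act u′ (α x)) (act-∼ e (α x)) y ⟩
    coeff (-ᵛ act u′ (α x)) y ∎

  -- A descent replaces `u` by a shorter word and, because `x` negates `α x`, flips the sign of the
  -- root. This can happen only finitely often.
  root-sign : ∀ n u x → length u ℕ.≤ n → NonNeg (act u (α x)) ⊎ NonNeg (-ᵛ act u (α x))
  root-sign n u x l with positive-or-descent n u x l
  root-sign n u x l | inj₁ 0≤ = inj₁ 0≤
  root-sign zero    u x l | inj₂ (_ , _ , lt) with ℕ.≤-trans lt l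
  ... | ()
  root-sign (suc n) u x l | inj₂ (u′ , e , lt)
    with root-sign n u′ x (ℕ.≤-pred (ℕ.≤-trans lt l))
  ... | inj₁ 0≤ = inj₂ (NonNeg-resp (act u′ (α x)) (-ᵛ act u (α x)) (λ y → sym (begin
          coeff (-ᵛ act u (α x)) y        ≈⟨ -ᵛ-cong (act u (α x)) (-ᵛ act u′ (α x)) (act-α≈-ᵛ u x e) y ⟩
          coeff (-ᵛ (-ᵛ act u′ (α x))) y  ≈⟨ -ᵛ-involutive (act u′ (α x)) y ⟩
          coeff (act u′ (α x)) y          ∎)) 0≤)
  ... | inj₂ 0≤ = inj₁ (NonNeg-resp (-ᵛ act u′ (α x)) (act u (α x))
          (𝕍.sym {act u (α x)} { -ᵛ act u′ (α x)} (act-α≈-ᵛ u x e)) 0≤)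

  -- If `vx` acts trivially, `v` sends `α x` to its negative, which is not nonnegative. Hence `vx`
  -- equals a word shorter than `v`, which acts trivially too.
  faithful : ∀ n u → length u ℕ.≤ n → (∀ v → act u v ≈ᵛ v) → u ∼ []
  faithful n u l triv with initLast u
  faithful n       .[]           l triv | []      = ∼-refl
  faithful n       .(v ++ [ x ]) l triv | v ∷ʳ′ x with positive-or-descent (length v) v x ℕ.≤-refl
  faithful n       .(v ++ [ x ]) l triv | v ∷ʳ′ x | inj₁ 0≤ =
    ⊥-elim (-α-not-NonNeg x (NonNeg-resp (act v (α x)) (-ᵛ α x) (λ y → trans (act-α≈-ᵛ v x ∼-refl y)
      (-ᵛ-cong (act (v ++ [ x ]) (α x)) (α x) (triv (α x)) y)) 0≤))
  faithful zero    .(v ++ [ x ]) l triv | v ∷ʳ′ x | inj₂ _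
    with ≡.subst (ℕ._≤ 0) (length-∷ʳ v x) l
  ... | ()
  faithful (suc n) .(v ++ [ x ]) l triv | v ∷ʳ′ x | inj₂ (u′ , e , lt) =
    ∼-trans e (faithful n u′
      (ℕ.≤-trans (ℕ.<⇒≤ lt) (ℕ.≤-pred (≡.subst (ℕ._≤ suc n) (length-∷ʳ v x) l)))
      (λ w → 𝕍.trans {act u′ w} {act (v ++ [ x ]) w} {w} (λ y → sym (act-∼ e w y)) (triv w)))

  -- Reflections are determined by their roots.

  act-inverseʳ : ∀ u v → act u (act (reverse u) v) ≈ᵛ v
  act-inverseʳ u v y = trans (sym (act-concat u (reverse u) v y))
                             (act-∼ (reverse-inverseʳ u) v y)

  act-inverseˡ : ∀ u v → act (reverse u) (act u v) ≈ᵛ v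
  act-inverseˡ u v y = trans (sym (act-concat (reverse u) u v y))
                             (act-∼ (reverse-inverseˡ u) v y)

  -- Both simple roots have norm 2 for the invariant form, so `2 k² = 2`, and 2 is invertible.
  unit-multiple : ∀ h x y k → act h (α y) ≈ᵛ k · α x → k * k ≈ 1#
  unit-multiple h x y k e = begin
    k * k                     ≈⟨ *-identityʳ (k * k) ⟨
    k * k * 1#                ≈⟨ *-congˡ 2h≈1 ⟨
    k * k * ((1# + 1#) * h₂)  ≈⟨ *-assoc (k * k) _ h₂ ⟨
    k * k * (1# + 1#) * h₂    ≈⟨ *-congʳ 2kk≈2 ⟩
    (1# + 1#) * h₂            ≈⟨ 2h≈1 ⟩
    1#                        ∎
    where
    h₂ = proj₁ half
    2h≈1 = proj₂ half
    norm : ∀ x → twoB x (α x) ≈ 1# + 1#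
    norm x = trans (+-identityʳ _) (trans (*-identityˡ _) (gram-diag x))
    2kk≈2 : k * k * (1# + 1#) ≈ 1# + 1#
    2kk≈2 = begin
      k * k * (1# + 1#)                   ≈⟨ *-congˡ (norm x) ⟨
      k * k * twoB x (α x)                ≈⟨ *-assoc k k _ ⟩
      k * (k * twoB x (α x))              ≈⟨ *-congˡ (twoB-· x k (α x)) ⟨
      k * twoB x (k · α x)                ≈⟨ *-congˡ (form-α x (k · α x)) ⟨
      k * form (α x) (k · α x)            ≈⟨ lin-· (λ z → twoB z (k · α x)) k (α x) ⟨
      form (k · α x) (k · α x)            ≈⟨ form-cong (act h (α y)) (k · α x) (act h (α y)) (k · α x) e e ⟨
      form (act h (α y)) (act h (α y))    ≈⟨ form-act h (α y) (α y) ⟩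
      form (α y) (α y)                    ≈⟨ form-α y (α y) ⟩
      twoB y (α y)                        ≈⟨ norm y ⟩
      1# + 1#                             ∎

  -- Conjugating the reflection in `α y` by `h` gives the reflection in `k α x`, whose formula
  -- contains `k` only through `k² = 1`.
  act-conjugate : ∀ h x y k → act h (α y) ≈ᵛ k · α x →
                  ∀ v → act (conjugate h [ y ]) v ≈ᵛ reflect x v
  act-conjugate h x y k e v z = begin
    coeff (act (conjugate h [ y ]) v) z
      ≈⟨ act-concat h (y ∷ reverse h) v z ⟩
    coeff (act h ([ (- p , y) ] ++ w)) z
      ≈⟨ act-++ h [ (- p , y) ] w z ⟩
    coeff (act h [ (- p , y) ] ++ act h w) z
      ≈⟨ coeff-++ (act h [ (- p , y) ]) (act h w) z ⟩
    coeff (act h [ (- p , y) ]) z + coeff (act h w) z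
      ≈⟨ +-cong (act-cong h [ (- p , y) ] ((- p) · α y) (singleton≈· (- p) y) z) (act-inverseʳ h v z) ⟩
    coeff (act h ((- p) · α y)) z + coeff v z
      ≈⟨ +-congʳ (trans (act-· h (- p) (α y) z) (coeff-· (- p) (act h (α y)) z)) ⟩
    - p * coeff (act h (α y)) z + coeff v z
      ≈⟨ +-congʳ (*-cong (-‿cong p≈) (trans (e z) (trans (coeff-· k (α x) z) (*-congˡ (coeff-α x z))))) ⟩
    - (k * twoB x v) * (k * δ z x) + coeff v z
      ≈⟨ +-congʳ (solve 3 (λ k b d → (:- (k :* b)) :* (k :* d) := (k :* k) :* ((:- b) :* d)) refl
           k (twoB x v) (δ z x)) ⟩
    k * k * (- twoB x v * δ z x) + coeff v z
      ≈⟨ +-congʳ (trans (*-congʳ (unit-multiple h x y k e)) (*-identityˡ _)) ⟩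
    - twoB x v * δ z x + coeff v z
      ≈⟨ coeff-reflect x v z ⟨
    coeff (reflect x v) z ∎
    where
    w = act (reverse h) v
    p = twoB y w
    -- Invariance of the form turns the pairing of `α y` with `h⁻¹ v` into that of `h (α y)` with
    -- `v`.
    p≈ : p ≈ k * twoB x v
    p≈ = begin
      twoB y w                    ≈⟨ form-α y w ⟨
      form (α y) w                ≈⟨ form-act h (α y) w ⟨
      form (act h (α y)) (act h w) ≈⟨ form-cong (act h (α y)) (k · α x) (act h w) v e (act-inverseʳ h v) ⟩
      form (k · α x) v            ≈⟨ lin-· (λ z → twoB z v) k (α x) ⟩
      k * form (α x) v            ≈⟨ *-congˡ (form-α x v) ⟩
      k * twoB x v                ∎

  -- Both sides act as the same reflection, and the representation is faithful.
  conjugate-simple : ∀ h x y k → act h (α y) ≈ᵛ k · α x → conjugate h [ y ] ∼ [ x ]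
  conjugate-simple h x y k e = ++∼[]⇒∼reverse (conjugate h [ y ]) [ x ]
    (faithful _ (conjugate h [ y ] ++ [ x ]) ℕ.≤-refl λ v z → begin
      coeff (act (conjugate h [ y ] ++ [ x ]) v) z
        ≈⟨ act-concat (conjugate h [ y ]) [ x ] v z ⟩
      coeff (act (conjugate h [ y ]) (reflect x v)) z
        ≈⟨ act-conjugate h x y k e (reflect x v) z ⟩
      coeff (reflect x (reflect x v)) z
        ≈⟨ reflect-involutive x v z ⟩
      coeff v z ∎)

  -- This recognises a reflection by its root: every word `h` that takes the root to a multiple of a
  -- simple root `α x` yields it as `h⁻¹ x h`.
  conjugate-root : ∀ h g x y k → act h (act g (α y)) ≈ᵛ k · α x →
                   conjugate g [ y ] ∼ conjugate (reverse h) [ x ]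
  conjugate-root h g x y k e = ∼-trans (∼-sym (conjugate-reverse h (conjugate g [ y ])))
    (conjugate-cong (reverse h) (≡.subst (_∼ [ x ]) (conjugate-++ h g [ y ])
      (conjugate-simple (h ++ g) x y k λ z →
        trans (act-concat h g (α y) z) (e z))))

  -- From `v - p α x = - v` follows `2 v = p α x`, so `k = p / 2`.
  reflect≈-ᵛ⇒multiple : ∀ x v → reflect x v ≈ᵛ -ᵛ v → ∃ λ k → v ≈ᵛ k · α x
  reflect≈-ᵛ⇒multiple x v e = h * p , λ y → begin
    coeff v y
      ≈⟨ trans (*-congʳ 2h≈1) (*-identityˡ _) ⟨
    (1# + 1#) * h * coeff v y
      ≈⟨ solve 3 (λ h a r → (:1 :+ :1) :* h :* a := h :* (r :+ a :- (r :- a))) refl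
           h (coeff v y) (p * δ y x) ⟩
    h * (p * δ y x + coeff v y - (p * δ y x - coeff v y))
      ≈⟨ *-congˡ (+-congˡ (-‿cong (step y))) ⟩
    h * (p * δ y x + coeff v y - coeff v y)
      ≈⟨ solve 4 (λ h p d a → h :* (p :* d :+ a :- a) := h :* p :* d) refl h p (δ y x) (coeff v y) ⟩
    h * p * δ y x
      ≈⟨ trans (coeff-· (h * p) (α x) y) (*-congˡ (coeff-α x y)) ⟨
    coeff ((h * p) · α x) y ∎
    where
    h = proj₁ half
    2h≈1 = proj₂ half
    p = twoB x v
    step : ∀ y → p * δ y x - coeff v y ≈ coeff v y
    step y = begin
      p * δ y x - coeff v y
        ≈⟨ solve 3 (λ p d a → p :* d :- a := :- ((:- p) :* d :+ a)) refl p (δ y x) (coeff v y) ⟩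
      - (- p * δ y x + coeff v y)
        ≈⟨ -‿cong (trans (sym (coeff-reflect x v y)) (trans (e y) (coeff--ᵛ v y))) ⟩
      - - coeff v y
        ≈⟨ -‿involutive _ ⟩
      coeff v y ∎

  -- Reflecting changes only the coefficient at `x`, so every other coefficient of `v` is both at
  -- least and at most 0.
  sign-change⇒multiple : ∀ x v → NonNeg v → NonNeg (-ᵛ reflect x v) → ∃ λ k → v ≈ᵛ k · α x
  sign-change⇒multiple x v 0≤v 0≤-xv = coeff v x , λ y →
    trans (eq y) (sym (trans (coeff-· (coeff v x) (α x) y) (*-congˡ (coeff-α x y))))
    where
    other : ∀ y → δ y x ≈ 0# → coeff v y ≈ 0#
    other y δ≈0 = antisym (0≤-⇒≤0 (≤-respʳ (begin
      coeff (-ᵛ reflect x v) y               ≈⟨ coeff--ᵛ (reflect x v) y ⟩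
      - coeff (reflect x v) y                ≈⟨ -‿cong (coeff-reflect x v y) ⟩
      - (- twoB x v * δ y x + coeff v y)     ≈⟨ -‿cong (+-congʳ (trans (*-congˡ δ≈0) (zeroʳ _))) ⟩
      - (0# + coeff v y)                     ≈⟨ -‿cong (+-identityˡ _) ⟩
      - coeff v y                            ∎) (0≤-xv y))) (0≤v y)
    eq : ∀ y → coeff v y ≈ coeff v x * δ y x
    eq y with x ≟ y
    ... | yes ≡.refl = sym (*-identityʳ _)
    ... | no  x≢y    = trans (other y (δ-≢ x≢y)) (sym (zeroʳ _))

  -- A root of both signs would be zero, and applying the inverse of `g` would make `α x` zero.
  root-not-zero : ∀ g x → NonNeg (act g (α x)) → ¬ NonNeg (-ᵛ act g (α x))
  root-not-zero g x 0≤ 0≤- = 0≉1 (begin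
    0#                                  ≈⟨ zeroˡ _ ⟨
    0# * coeff (act (reverse g) β) x    ≈⟨ coeff-· 0# (act (reverse g) β) x ⟨
    coeff (0# · act (reverse g) β) x    ≈⟨ act-· (reverse g) 0# β x ⟨
    coeff (act (reverse g) (0# · β)) x  ≈⟨ act-cong (reverse g) (0# · β) β 0β≈β x ⟩
    coeff (act (reverse g) β) x         ≈⟨ act-inverseˡ g (α x) x ⟩
    coeff (α x) x                       ≈⟨ trans (coeff-α x x) (δ-refl x) ⟩
    1#                                  ∎)
    where
    β = act g (α x)
    0β≈β : 0# · β ≈ᵛ β
    0β≈β y = trans (coeff-· 0# β y) (trans (zeroˡ _)
      (antisym (0≤ y) (0≤-⇒≤0 (≤-respʳ (coeff--ᵛ β y) (0≤- y)))))

-- From words to group elements.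

module Depth {s c ℓ f ℓ₁ ℓ₂}
             (C : CoxeterSystem s c ℓ) (F : OrderedField f ℓ₁ ℓ₂)
             (cosines : Cosines C F) where
  open CoxeterSystem C
  private module K = CommutativeRing (OrderedField.commutativeRing F)
  open RootSystem C F cosines
  open Group group
    using (setoid; refl; sym; trans; ∙-cong; ∙-congˡ; ∙-congʳ; identityˡ; identityʳ;
           assoc; ⁻¹-cong)
  open GroupProperties group using (inverseˡ-unique)
  open Representation C F cosines
  open Words matrix
  private module ≈-Reasoning = SetoidReasoning setoid

  ⟦⟧-++ : ∀ u v → ⟦ u ++ v ⟧ ≈ ⟦ u ⟧ ∙ ⟦ v ⟧
  ⟦⟧-++ []      v = sym (identityˡ _)
  ⟦⟧-++ (x ∷ u) v = trans (∙-congˡ (⟦⟧-++ u v)) (sym (assoc _ _ _))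

  ⟦⟧-cong : ∀ {u v} → u ∼ v → ⟦ u ⟧ ≈ ⟦ v ⟧
  ⟦⟧-cong {u} {v} = Equivalence.from (presents u v)

  ⟦⟧-reverse : ∀ u → ⟦ reverse u ⟧ ≈ ⟦ u ⟧ ⁻¹
  ⟦⟧-reverse u = inverseˡ-unique _ _
    (trans (sym (⟦⟧-++ (reverse u) u)) (⟦⟧-cong (reverse-inverseˡ u)))

  ⟦⟧-conjugate : ∀ u x → ⟦ conjugate u [ x ] ⟧ ≈ ⟦ u ⟧ ∙ σ x ∙ ⟦ u ⟧ ⁻¹
  ⟦⟧-conjugate u x = begin
    ⟦ conjugate u [ x ] ⟧             ≈⟨ ⟦⟧-++ u (x ∷ reverse u) ⟩
    ⟦ u ⟧ ∙ (σ x ∙ ⟦ reverse u ⟧)     ≈⟨ assoc _ _ _ ⟨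
    ⟦ u ⟧ ∙ σ x ∙ ⟦ reverse u ⟧       ≈⟨ ∙-congˡ (⟦⟧-reverse u) ⟩
    ⟦ u ⟧ ∙ σ x ∙ ⟦ u ⟧ ⁻¹            ∎
    where open ≈-Reasoning

  -- By the presentation, two words for the same element are congruent, and congruent words act
  -- alike; any word may thus replace the chosen `word w`.
  •≈act : ∀ w u → w ≈ ⟦ u ⟧ → ∀ v → w • v ≈ᵛ act u v
  •≈act w u e = act-∼ (Equivalence.to (presents (word w) u) (trans (proj₂ (generates w)) e))

  act∈Φ : ∀ u x β → β ≈ᵛ act u (α x) → Φ β
  act∈Φ u x β e = ⟦ u ⟧ , x ,
    𝕍.trans {β} {act u (α x)} {⟦ u ⟧ • α x} e
      (𝕍.sym {⟦ u ⟧ • α x} {act u (α x)} (•≈act ⟦ u ⟧ u refl (α x)))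

  -- Simple reflections as factors of depth 1.

  α∈Π : ∀ x → Π (α x)
  α∈Π x = act∈Φ [] x (α x) (𝕍.refl {α x}) , NonNeg-α x

  simple-depth : ∀ x → IsRootDepth (α x) 1
  simple-depth x = ([ x ] , ≡.refl , act∈Φ [] x (-ᵛ reflect x (α x)) eq , 0≤) , minimal
    where
    eq : -ᵛ reflect x (α x) ≈ᵛ α x
    eq = 𝕍.trans { -ᵛ reflect x (α x)} { -ᵛ (-ᵛ α x)} {α x}
           (-ᵛ-cong (reflect x (α x)) (-ᵛ α x) (reflect-α x)) (-ᵛ-involutive (α x))
    0≤ : NonNeg (-ᵛ reflect x (α x))
    0≤ = NonNeg-resp (α x) (-ᵛ reflect x (α x))
           (𝕍.sym { -ᵛ reflect x (α x)} {α x} eq) (NonNeg-α x)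
    minimal : ∀ k → (∃ λ u → length u ≡ k × -Π (act u (α x))) → 1 ℕ.≤ k
    minimal (suc k) _                   = s≤s z≤n
    -- The empty word leaves `α x`, which is not negative.
    minimal zero    ([] , _ , _ , 0≤-α) = ⊥-elim (-α-not-NonNeg x 0≤-α)

  σ∈T : ∀ x → T (σ x)
  σ∈T x = ⟦ [] ⟧ , x , trans (sym (identityʳ _)) (⟦⟧-conjugate [] x)

  simpleFactor : S → Factor
  simpleFactor x = record
    { β        = α x
    ; β∈Π      = α∈Π x
    ; t        = σ x
    ; t∈T      = σ∈T x
    ; t•β≈-β   = 𝕍.trans {σ x • α x} {reflect x (α x)} { -ᵛ α x}
                   (•≈act (σ x) [ x ] (sym (identityʳ _)) (α x)) (reflect-α x)
    ; dpβ      = 1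
    ; isDepthβ = simple-depth x
    }

  -- For the upper bound: the letters of a word are factors of depth 1.
  simple-expression : ∀ u → ∃ λ (ts : List Factor) →
    ⟦ u ⟧ ≈ product (map Factor.t ts) × foldr ℕ._+_ 0 (map Factor.dpβ ts) ≡ length u
  simple-expression []      = [] , refl , ≡.refl
  simple-expression (x ∷ u) with simple-expression u
  ... | ts , e , l = simpleFactor x ∷ ts , ∙-congˡ e , ≡.cong suc l

  -- The length of a reflection against the depth of its root.

  module _ (factor : Factor) where
    open Factor factor

    -- The bound ℓ_S(t_β) ≤ 2 dp(β) - 1.
    short-word : ∃ λ v → t ≈ ⟦ v ⟧ × suc (length v) ≡ dpβ ℕ.+ dpβ
    short-word with t∈T | β∈Π | isDepthβ
    -- Depth 0 would make `β` both positive and negative.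
    ... | w , x , t≈ | (w′ , y , β≈) , 0≤β | ([] , _ , _ , 0≤-β) , _ =
      ⊥-elim (root-not-zero (word w′) y
        (NonNeg-resp β (w′ • α y) β≈ 0≤β)
        (NonNeg-resp (-ᵛ β) (-ᵛ (w′ • α y)) (-ᵛ-cong β (w′ • α y) β≈) 0≤-β))
    ... | w , x , t≈ | (w′ , y , β≈) , 0≤β | (z ∷ u , ≡.refl , _ , 0≤-zγ) , minimal =
      conjugate (reverse u) [ z ] , t≈short , length-short
      where
      g = word w′
      h = word w
      γ = act u β
      γ≈ : γ ≈ᵛ act (u ++ g) (α y)
      γ≈ a = K.trans (act-cong u β (act g (α y)) β≈ a)
                     (K.sym (act-concat u g (α y) a))
      -γ≈ : -ᵛ γ ≈ᵛ act ((u ++ g) ++ [ y ]) (α y)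
      -γ≈ a = K.trans (-ᵛ-cong γ (act (u ++ g) (α y)) γ≈ a)
                      (K.sym (act-∷ʳ-α (u ++ g) y a))
      -- Otherwise `u`, one letter shorter than `z ∷ u`, would already make `β` negative, against
      -- minimality.
      0≤γ : NonNeg γ
      0≤γ with root-sign _ (u ++ g) y ℕ.≤-refl
      ... | inj₁ 0≤ = NonNeg-resp (act (u ++ g) (α y)) γ (𝕍.sym {γ} {act (u ++ g) (α y)} γ≈) 0≤
      ... | inj₂ 0≤ = ⊥-elim (ℕ.1+n≰n (minimal (length u) (u , ≡.refl ,
              act∈Φ ((u ++ g) ++ [ y ]) y (-ᵛ γ) -γ≈ ,
              NonNeg-resp (-ᵛ act (u ++ g) (α y)) (-ᵛ γ)
                (𝕍.sym { -ᵛ γ} { -ᵛ act (u ++ g) (α y)} (-ᵛ-cong γ (act (u ++ g) (α y)) γ≈)) 0≤)))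
      t≈conjugate : t ≈ ⟦ conjugate h [ x ] ⟧
      t≈conjugate = trans t≈ (sym (trans (⟦⟧-conjugate h x)
        (∙-cong (∙-congʳ (proj₂ (generates w))) (⁻¹-cong (proj₂ (generates w))))))
      -- A factor only records that `t` is a reflection negating `β`. With `t = h x h⁻¹`, the simple
      -- reflection `x` negates `h⁻¹ β`, which is therefore a multiple of `α x`.
      γ′ = act (reverse h) β
      xγ′≈-γ′ : reflect x γ′ ≈ᵛ -ᵛ γ′
      xγ′≈-γ′ a = K.trans (K.sym (act-inverseˡ h (reflect x γ′) a))
        (K.trans (act-cong (reverse h) (act h (reflect x γ′)) (-ᵛ β) tβ≈-β a)
                 (act--ᵛ (reverse h) β a))
        where
        tβ≈-β : act h (reflect x γ′) ≈ᵛ -ᵛ β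
        tβ≈-β b = K.trans (K.sym (act-concat h (x ∷ reverse h) β b))
          (K.trans (K.sym (•≈act t (conjugate h [ x ]) t≈conjugate β b)) (t•β≈-β b))
      γ-multiple = sign-change⇒multiple z γ 0≤γ 0≤-zγ
      γ′-multiple = reflect≈-ᵛ⇒multiple x γ′ xγ′≈-γ′
      rootAt : ∀ r x k → act r β ≈ᵛ k · α x → conjugate g [ y ] ∼ conjugate (reverse r) [ x ]
      rootAt r x k e = conjugate-root r g x y k
        (𝕍.trans {act r (act g (α y))} {act r β} {k · α x}
          (𝕍.sym {act r β} {act r (act g (α y))} (act-cong r β (act g (α y)) β≈)) e)
      -- Both `h x h⁻¹` and `u⁻¹ z u` agree with `g y g⁻¹`, since `h⁻¹` and `u` take `β = g (α y)`
      -- to multiples of `α x` and `α z`.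
      t≈short : t ≈ ⟦ conjugate (reverse u) [ z ] ⟧
      t≈short = trans t≈conjugate (⟦⟧-cong (∼-trans
        (∼-sym (≡.subst (λ r → conjugate g [ y ] ∼ conjugate r [ x ]) (reverse-involutive h)
          (rootAt (reverse h) x (proj₁ γ′-multiple) (proj₂ γ′-multiple))))
        (rootAt u z (proj₁ γ-multiple) (proj₂ γ-multiple))))
      length-short : suc (length (conjugate (reverse u) [ z ])) ≡ suc (length u) ℕ.+ suc (length u)
      length-short = ≡.cong suc (≡.trans (length-++ (reverse u))
        (≡.cong₂ (λ m n → m ℕ.+ suc n) (length-reverse u)
          (≡.trans (length-reverse (reverse u)) (length-reverse u))))

  -- A factor of depth `d` adds 1 to the number of factors and `2 d - 1` letters to the word.
  expression-word : ∀ (ts : List Factor) → ∃ λ v → product (map Factor.t ts) ≈ ⟦ v ⟧ ×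
    length ts ℕ.+ length v ≡ foldr ℕ._+_ 0 (map Factor.dpβ ts) ℕ.* 2
  expression-word []       = [] , refl , ≡.refl
  expression-word (t ∷ ts) with short-word t | expression-word ts
  ... | v , t≈v , l | vs , ts≈vs , ls = v ++ vs , trans (∙-cong t≈v ts≈vs) (sym (⟦⟧-++ v vs)) , eq
    where
    d = Factor.dpβ t
    ds = foldr ℕ._+_ 0 (map Factor.dpβ ts)
    open CommutativeSemigroupProperties ℕ.+-commutativeSemigroup using (x∙yz≈y∙xz)
    open ≡-Reasoning
    eq : suc (length ts) ℕ.+ length (v ++ vs) ≡ (d ℕ.+ ds) ℕ.* 2
    eq = begin
      suc (length ts) ℕ.+ length (v ++ vs)
        ≡⟨ ≡.cong (λ n → suc (length ts ℕ.+ n)) (length-++ v) ⟩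
      suc (length ts ℕ.+ (length v ℕ.+ length vs))
        ≡⟨ ≡.cong suc (x∙yz≈y∙xz (length ts) (length v) (length vs)) ⟩
      suc (length v) ℕ.+ (length ts ℕ.+ length vs)
        ≡⟨ ≡.cong₂ ℕ._+_ l ls ⟩
      d ℕ.+ d ℕ.+ ds ℕ.* 2
        ≡⟨ ≡.cong (λ n → d ℕ.+ n ℕ.+ ds ℕ.* 2) (ℕ.+-identityʳ d) ⟨
      2 ℕ.* d ℕ.+ ds ℕ.* 2
        ≡⟨ ≡.cong (ℕ._+ ds ℕ.* 2) (ℕ.*-comm 2 d) ⟩
      d ℕ.* 2 ℕ.+ ds ℕ.* 2
        ≡⟨ ℕ.*-distribʳ-+ 2 d ds ⟨
      (d ℕ.+ ds) ℕ.* 2 ∎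

  all-reflections : ∀ (ts : List Factor) → All T (map Factor.t ts)
  all-reflections []       = []
  all-reflections (t ∷ ts) = Factor.t∈T t ∷ all-reflections ts

-- Passage to rational numbers and the two inequalities.

open import Data.Rational.Base using (_/_; _≤_; toℚᵘ)

-- On unnormalised fractions the order is cross-multiplication, which gives back the hypothesis on
-- natural numbers.
half-≤ : ∀ m n → m ℕ.≤ n ℕ.* 2 → (+ m) / 2 ≤ (+ n) / 1
half-≤ m n m≤2n = ℚ.toℚᵘ-cancel-≤ (begin
  toℚᵘ ((+ m) / 2)         ≃⟨ ℚ.toℚᵘ-fromℚᵘ ((+ m) ℚᵘ./ 2) ⟩
  (+ m) ℚᵘ./ 2             ≤⟨ ℚᵘ.*≤* (≡.subst (ℤ._≤ (+ n) ℤ.* + 2) (≡.sym (ℤ.*-identityʳ (+ m)))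
                               (≡.subst (+ m ℤ.≤_) (ℤ.pos-* n 2) (ℤ.+≤+ m≤2n))) ⟩
  (+ n) ℚᵘ./ 1             ≃⟨ ℚ.toℚᵘ-fromℚᵘ ((+ n) ℚᵘ./ 1) ⟨
  toℚᵘ ((+ n) / 1)         ∎)
  where open ℚᵘ.≤-Reasoning

mainTheorem4 : ∀ {s c ℓ f ℓ₁ ℓ₂}
    (C : CoxeterSystem s c ℓ) (F : OrderedField f ℓ₁ ℓ₂) (cosines : Cosines C F)
    (w : CoxeterSystem.W C) (ℓT ℓS dp : ℕ) →
    CoxeterSystem.IsLengthT C w ℓT →
    CoxeterSystem.IsLengthS C w ℓS →
    RootSystem.IsDepth C F cosines w dp →
    ((+ (ℓT ℕ.+ ℓS)) / 2 ≤ (+ dp) / 1) × (dp ℕ.≤ ℓS)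
mainTheorem4 C F cosines w ℓT ℓS dp (_ , minT) ((u , ℓu , w≈u) , minS) ((ts , w≈ts , Σts) , minD)
  with Depth.expression-word C F cosines ts | Depth.simple-expression C F cosines u
... | v , ts≈v , lv | us , u≈us , Σus =
  -- The word `u` has length `ℓS`, so its letters form an expression of total depth `ℓS`.
  half-≤ (ℓT ℕ.+ ℓS) dp ℓT+ℓS≤2dp , minD ℓS (us , trans w≈u u≈us , ≡.trans Σus ℓu)
  where
  open Group (CoxeterSystem.group C) using (trans)
  open RootSystem C F cosines using (Factor)
  -- The factors `ts` attain the depth of `w`. Being reflections, they bound `ℓT` by their number;
  -- the word `v` built from them bounds `ℓS`.
  ℓT≤ : ℓT ℕ.≤ length ts
  ℓT≤ = minT (length ts)
    (map Factor.t ts , Depth.all-reflections C F cosines ts , length-map Factor.t ts , w≈ts)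
  ℓS≤ : ℓS ℕ.≤ length v
  ℓS≤ = minS (length v) (v , ≡.refl , trans w≈ts ts≈v)
  ℓT+ℓS≤2dp : ℓT ℕ.+ ℓS ℕ.≤ dp ℕ.* 2
  ℓT+ℓS≤2dp = ℕ.≤-trans (ℕ.+-mono-≤ ℓT≤ ℓS≤)
    (ℕ.≤-reflexive (≡.trans lv (≡.cong (ℕ._* 2) Σts)))
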